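{- For each of the following sets $R\subseteq\{0,1,2,3\}^2$ we have $(123,R)\sim_d(132,R)$: (1) $R=\{(0,0),(0,2),(0,3),(1,2),(2,0),(2,1),(2,3),(3,0),(3,2)\}$; (2) $R=\{(0,0),(0,2),(0,3),(1,2),(2,0),(2,1),(2,2),(2,3),(3,0),(3,2)\}$; (3) $R=\{(0,0),(0,2),(0,3),(1,1),(1,2),(1,3),(2,0),(2,1),(2,3),(3,0),(3,1),(3,2),(3,3)\}$; (4) $R=\{(0,0),(0,2),(0,3),(1,1),(1,2),(1,3),(2,0),(2,1),(2,2),(2,3),(3,0),(3,1),(3,2),(3,3)\}$.
   Context: $S_n$ denotes the set of permutations of $[n]=\{1,\dots,n\}$, written $\pi=\pi_1\cdots\pi_n$. A mesh pattern of length $k$ is a pair $(\tau,R)$ with $\tau\in S_k$ and $R\subseteq\{0,1,\dots,k\}^2$ (the shaded boxes; box $(a,b)$ is the unit square $[a,a+1]\times[b,b+1]$ in the diagram of $\tau$). An occurrence of $(\tau,R)$ in $\pi\in S_n$ is a choice of indices $i_1<\dots<i_k$ such that $\pi_{i_1}\cdots\pi_{i_k}$ is order-isomorphic to $\tau$ and, with $i_0=0$, $i_{k+1}=n+1$, $v_1<\dots<v_k$ the values $\pi_{i_1},\dots,\pi_{i_k}$ sorted increasingly, $v_0=0$, $v_{k+1}=n+1$, for every $(a,b)\in R$ there is no index $m$ with $i_a<m<i_{a+1}$ and $v_b<\pi_m<v_{b+1}$. Mesh patterns $p,q$ are equidistributed, $p\sim_d q$, if for all $n,\ell\ge0$ the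 number of $\pi\in S_n$ with exactly $\ell$ occurrences of $p$ equals the number with exactly $\ell$ occurrences of $q$. -}

module Defs where

open import Data.Nat using (ℕ; zero; suc; _+_; _<ᵇ_; _≡ᵇ_)
open import Data.Bool using (Bool; true; false; _∧_; _∨_; not; if_then_else_)
open import Data.List using (List; []; _∷_; length; map; filter; concatMap; _++_; applyUpTo)
open import Data.Bool.ListAction using (all; any)
open import Data.Product using (_×_; _,_)
open import Relation.Binary.PropositionalEquality using (_≡_)
open import Relation.Nullary.Decidable using (does)
open import Data.Bool.Properties using (T?)

-- Conventions: a permutation π ∈ S_n is the list π₁ ⋯ πₙ of its values
-- (values in 1..n, positions 1-based).  A mesh pattern is a pair (τ , R)
-- with τ ∈ S_k given as a list and R a list of shaded boxes (a , b).

record MeshPattern : Set where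
  constructor mesh
  field
    τ : List ℕ
    R : List (ℕ × ℕ)
open MeshPattern public

range1 : ℕ → List ℕ
range1 n = applyUpTo suc n

-- 1-based lookup (default 0 outside the list)
at : List ℕ → ℕ → ℕ
at []       _             = 0
at (x ∷ xs) zero          = 0
at (x ∷ xs) (suc zero)    = x
at (x ∷ xs) (suc (suc m)) = at xs (suc m)

elemᵇ : ℕ → List ℕ → Bool
elemᵇ v xs = any (λ x → x ≡ᵇ v) xs

words : ℕ → ℕ → List (List ℕ)
words n zero      = [] ∷ []
words n (suc len) = concatMap (λ v → map (v ∷_) (words n len)) (range1 n)

isPerm : ℕ → List ℕ → Bool
isPerm n π = (length π ≡ᵇ n) ∧ all (λ v → elemᵇ v π) (range1 n)

Sn : ℕ → List (List ℕ)
Sn n = filter (λ π → T? (isPerm n π)) (words n n)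

choose : ℕ → List ℕ → List (List ℕ)
choose zero    _        = [] ∷ []
choose (suc k) []       = []
choose (suc k) (x ∷ xs) = map (x ∷_) (choose k xs) ++ choose (suc k) xs

orderIso : List ℕ → List ℕ → Bool
orderIso xs ys =
  (length xs ≡ᵇ length ys) ∧
  all (λ a → all (λ b → ((at xs a <ᵇ at xs b) ∧ (at ys a <ᵇ at ys b))
                        ∨ (not (at xs a <ᵇ at xs b) ∧ not (at ys a <ᵇ at ys b)))
                 (range1 (length xs)))
      (range1 (length xs))

insert : ℕ → List ℕ → List ℕ
insert x []       = x ∷ []
insert x (y ∷ ys) = if x <ᵇ y then x ∷ y ∷ ys else y ∷ insert x ys

sort : List ℕ → List ℕ
sort []       = []
sort (x ∷ xs) = insert x (sort xs)

-- 0-based lookup into (0 ∷ xs ++ [n+1]) : gives i_a (resp. v_b) with the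
-- conventions i_0 = v_0 = 0 and i_{k+1} = v_{k+1} = n+1
ext : ℕ → List ℕ → ℕ → ℕ
ext n xs zero    = 0
ext n xs (suc a) = if a <ᵇ length xs then at xs (suc a) else suc n

boxEmpty : ℕ → List ℕ → List ℕ → ℕ × ℕ → Bool
boxEmpty n π is (a , b) =
  let vs = sort (map (at π) is) in
  not (any (λ m → (ext n is a <ᵇ m) ∧ (m <ᵇ ext n is (suc a))
                ∧ (ext n vs b <ᵇ at π m) ∧ (at π m <ᵇ ext n vs (suc b)))
           (range1 n))

isOcc : MeshPattern → ℕ → List ℕ → List ℕ → Bool
isOcc p n π is = orderIso (map (at π) is) (τ p) ∧ all (boxEmpty n π is) (R p)

occ : MeshPattern → List ℕ → ℕ
occ p π = length (filter (λ is → T? (isOcc p (length π) π is))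
                         (choose (length (τ p)) (range1 (length π))))

count : MeshPattern → ℕ → ℕ → ℕ
count p n ℓ = length (filter (λ π → T? (occ p π ≡ᵇ ℓ)) (Sn n))

_∼d_ : MeshPattern → MeshPattern → Set
p ∼d q = ∀ n ℓ → count p n ℓ ≡ count q n ℓ

R1 R2 R3 R4 : List (ℕ × ℕ)
R1 = (0 , 0) ∷ (0 , 2) ∷ (0 , 3) ∷ (1 , 2) ∷ (2 , 0) ∷ (2 , 1) ∷ (2 , 3) ∷ (3 , 0) ∷ (3 , 2) ∷ []
R2 = (0 , 0) ∷ (0 , 2) ∷ (0 , 3) ∷ (1 , 2) ∷ (2 , 0) ∷ (2 , 1) ∷ (2 , 2) ∷ (2 , 3) ∷ (3 , 0) ∷ (3 , 2) ∷ []
R3 = (0 , 0) ∷ (0 , 2) ∷ (0 , 3) ∷ (1 , 1) ∷ (1 , 2) ∷ (1 , 3) ∷ (2 , 0) ∷ (2 , 1) ∷ (2 , 3) ∷ (3 , 0) ∷ (3 , 1) ∷ (3 , 2) ∷ (3 , 3) ∷ []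
R4 = (0 , 0) ∷ (0 , 2) ∷ (0 , 3) ∷ (1 , 1) ∷ (1 , 2) ∷ (1 , 3) ∷ (2 , 0) ∷ (2 , 1) ∷ (2 , 2) ∷ (2 , 3) ∷ (3 , 0) ∷ (3 , 1) ∷ (3 , 2) ∷ (3 , 3) ∷ []

p123 p132 : List ℕ
p123 = 1 ∷ 2 ∷ 3 ∷ []
p132 = 1 ∷ 3 ∷ 2 ∷ []

{-# OPTIONS --safe #-}
module Submission where

-- Under each of the four shadings, an occurrence (i , j , k) of 123 or 132 consists of an interval
-- block of positions j..k whose extreme values sit at its two ends (the smaller one first for 123,
-- the larger one first for 132) and a point i south-west of the block whose position relative to it
-- is restricted by the shading; say that i is good for the block.  Call a block hot if some i is
-- good for it.  If two hot blocks share a point, then whatever is good for one is good for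
-- both and for their union, and a point that is good for some block lies in no hot block.  Hence
-- the maximal hot blocks are disjoint, and reversing each of them in place turns 123-occurrences
-- into 132-occurrences and conversely.  Reversal does not change the set of maximal hot blocks, so
-- it is an involution on permutations exchanging the two statistics.

open import Defs
open import Data.Nat
open import Data.Nat.Properties
open import Data.Bool using (Bool; true; false; T; not)
open import Data.Bool.Properties using (T-∧; T-∨; T-≡; ¬-not; T?)
open import Data.Bool.ListAction using (any)
open import Data.Empty using (⊥)
open import Data.List using (List; []; _∷_; map; length; filter; _++_; applyUpTo; concatMap; cartesianProductWith)
open import Data.List.Properties
  using (filter-notAll; map-applyUpTo; length-applyUpTo; length-map; length-++-sucʳ; ∷-injective; ∷-injectiveˡ; ∷-injectiveʳ)
open import Data.List.Membership.Propositional using (_∈_; find; lose)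
open import Data.List.Membership.Propositional.Properties
open import Data.List.Relation.Unary.All as All using (All; []; _∷_)
open import Data.List.Relation.Unary.All.Properties as All using (all⁺; all⁻)
open import Data.List.Relation.Unary.AllPairs as AllPairs using (AllPairs; []; _∷_)
import Data.List.Relation.Unary.AllPairs.Properties as AllPairs
open import Data.List.Relation.Unary.Any as Any using (here; there)
open import Data.List.Relation.Unary.Any.Properties using (any⁺; any⁻)
open import Data.List.Relation.Unary.Unique.Propositional using (Unique)
import Data.List.Relation.Unary.Unique.Propositional.Properties as Unique
open import Data.Product using (_×_; _,_; proj₁; proj₂; ∃; ∃-syntax)
open import Data.Sum using (_⊎_; inj₁; inj₂; [_,_]′)
open import Data.Unit using (tt)
open import Function using (_∘_; id; case_of_; _⇔_; mk⇔; Equivalence)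
open import Relation.Binary using (tri<; tri≈; tri>)
open import Relation.Binary.PropositionalEquality
open import Relation.Nullary using (¬_; Dec; yes; no; contradiction)
open import Relation.Nullary.Decidable using (map′; _×-dec_; _→-dec_; ¬?)
open import Relation.Unary using (Decidable)

open Equivalence using (to; from)

private
  variable
    A B : Set
    f g ρ : ℕ → ℕ
    n p q a b a′ b′ i j k m r r′ x y z : ℕ
    π is ys : List ℕ
    Q : List (ℕ × ℕ)
    α φ : Bool

-- Intervals of positions, bounded search and mirror images

infix 4 _∈[_,_]

_∈[_,_] : ℕ → ℕ → ℕ → Set
x ∈[ a , b ] = a ≤ x × x ≤ b

_∈[_,_]? : ∀ x a b → Dec (x ∈[ a , b ])
x ∈[ a , b ]? = (a ≤? x) ×-dec (x ≤? b)

∀∈? : {P : ℕ → Set} → Decidable P → ∀ a b → Dec (∀ x → x ∈[ a , b ] → P x)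
∀∈? P? a b = map′ (λ h x (a≤x , x≤b) → h (s≤s x≤b) a≤x) (λ h {x} x<1+b a≤x → h x (a≤x , s≤s⁻¹ x<1+b))
  (allUpTo? (λ x → (a ≤? x) →-dec P? x) (suc b))

∃≤? : {P : ℕ → Set} → Decidable P → ∀ n → Dec (∃[ x ] x ≤ n × P x)
∃≤? P? n = map′ (λ (x , x<n , Px) → x , s≤s⁻¹ x<n , Px) (λ (x , x≤n , Px) → x , s≤s x≤n , Px)
  (anyUpTo? P? (suc n))

greatest : {P : ℕ → Set} → Decidable P → ∀ n →
  (∃[ x ] P x × (∀ {y} → y ≤ n → P y → y ≤ x)) ⊎ (∀ {x} → x ≤ n → ¬ P x)
greatest P? zero with P? 0
... | yes P0 = inj₁ (0 , P0 , λ y≤0 _ → y≤0)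
... | no ¬P0 = inj₂ λ { z≤n → ¬P0 }
greatest P? (suc n) with P? (suc n)
... | yes Pn = inj₁ (suc n , Pn , λ y≤n _ → y≤n)
... | no ¬Pn with greatest P? n
...   | inj₁ (x , Px , max) = inj₁ (x , Px , λ y≤1+n Py →
          max (s≤s⁻¹ (≤∧≢⇒< y≤1+n λ { refl → ¬Pn Py })) Py)
...   | inj₂ none = inj₂ λ x≤1+n Px → none (s≤s⁻¹ (≤∧≢⇒< x≤1+n λ { refl → ¬Pn Px })) Px

-- `r` and `r′` mirror `x` and `y` about one centre; equal sums express this without truncated
-- subtraction.
+-antitone-≤ : r + x ≡ r′ + y → x ≤ y → r′ ≤ r
+-antitone-≤ {r} {x} {r′} {y} eq x≤y =
  +-cancelʳ-≤ y r′ r (≤-trans (≤-reflexive (sym eq)) (+-monoʳ-≤ r x≤y))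

mirror-∈ : r + x ≡ a + b → x ∈[ a , b ] → r ∈[ a , b ]
mirror-∈ {a = a} {b} eq (a≤x , x≤b) =
  +-antitone-≤ eq x≤b , +-antitone-≤ (trans (+-comm b a) (sym eq)) a≤x

∉-cases : ¬ x ∈[ a , b ] → x < a ⊎ b < x
∉-cases {x} {a} {b} x∉ with x <? a | b <? x
... | yes x<a | _       = inj₁ x<a
... | no _    | yes b<x = inj₂ b<x
... | no x≮a  | no b≮x  = contradiction (≮⇒≥ x≮a , ≮⇒≥ b≮x) x∉

-- Good points of a block

-- p plays the role of the letter 1 of the pattern, and the points at positions a..b form the
-- block between the other two letters; the fields are what the shading R1 says about them.
record Good (f : ℕ → ℕ) (n p a b : ℕ) : Set where
  constructor good
  field
    1≤p      : 1 ≤ p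
    p<a      : p < a
    a≤b      : a ≤ b
    b≤n      : b ≤ n
    above    : ∀ {x} → x ∈[ a , b ] → f p < f x
    left     : ∀ {m} → m ∈[ 1 , n ] → m < p → f p < f m × (∀ {x} → x ∈[ a , b ] → f m < f x)
    right    : ∀ {m} → m ∈[ 1 , n ] → b < m → f p < f m
    interval : ∀ {m} → m ∈[ 1 , n ] → ¬ m ∈[ a , b ] →
               ∀ {x} → x ∈[ a , b ] → ∀ {y} → y ∈[ a , b ] → f m < f x → f m < f y

  inside : x ∈[ a , b ] → x ∈[ 1 , n ]
  inside (a≤x , x≤b) = ≤-trans 1≤p (≤-trans (<⇒≤ p<a) a≤x) , ≤-trans x≤b b≤n

  p∈ : p ∈[ 1 , n ]
  p∈ = 1≤p , ≤-trans (<⇒≤ p<a) (≤-trans a≤b b≤n)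

open Good

-- Every condition ranges over a bounded interval of positions, so finitely many checks decide it;
-- `turn` searches with this test.
good? : ∀ f n p a b → Dec (Good f n p a b)
good? f n p a b = map′
  (λ (h₁ , h₂ , h₃ , h₄ , h₅ , h₆ , h₇ , h₈) → good h₁ h₂ h₃ h₄ (h₅ _)
    (λ m∈ m<p → proj₁ (h₆ _ m∈ m<p) , λ {x} → proj₂ (h₆ _ m∈ m<p) x) (h₇ _)
    (λ m∈ m∉ {x} x∈ {y} → h₈ _ m∈ m∉ x x∈ y))
  (λ G → 1≤p G , p<a G , a≤b G , b≤n G , (λ _ → above G)
       , (λ _ m∈ m<p → proj₁ (left G m∈ m<p) , λ _ → proj₂ (left G m∈ m<p)) , (λ _ → right G)
       , (λ _ m∈ m∉ _ x∈ _ → interval G m∈ m∉ x∈))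
  ((1 ≤? p) ×-dec (p <? a) ×-dec (a ≤? b) ×-dec (b ≤? n)
   ×-dec ∀∈? (λ x → f p <? f x) a b
   ×-dec ∀∈? (λ m → (m <? p) →-dec ((f p <? f m) ×-dec ∀∈? (λ x → f m <? f x) a b)) 1 n
   ×-dec ∀∈? (λ m → (b <? m) →-dec (f p <? f m)) 1 n
   ×-dec ∀∈? (λ m → ¬? (m ∈[ a , b ]?) →-dec
           ∀∈? (λ x → ∀∈? (λ y → (f m <? f x) →-dec (f m <? f y)) a b) a b) 1 n)

-- Inside the block of `q`, the point `p` would be above and to the right of `q`; but every point
-- left of `p` is higher than `p`.
good-∉ : Good f n p a b → Good f n q a′ b′ → ¬ p ∈[ a′ , b′ ]
good-∉ G H p∈ = <-asym (above H p∈) (proj₁ (left G (Good.p∈ H) (<-≤-trans (p<a H) (proj₁ p∈))))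

good-before : Good f n p a b → Good f n q a′ b′ → z ∈[ a , b ] → z ∈[ a′ , b′ ] → p < a′
good-before G H (a≤z , _) (_ , z≤b′) =
  ≰⇒> λ a′≤p → good-∉ G H (a′≤p , ≤-trans (<⇒≤ (p<a G)) (≤-trans a≤z z≤b′))

-- `p` and all points left of it lie outside the second block, hence compare with all its points as
-- they do with `z`.
good-transfer : Good f n p a b → Good f n q a′ b′ → z ∈[ a , b ] → z ∈[ a′ , b′ ] → Good f n p a′ b′
good-transfer G H z∈ z∈′ = record
  { 1≤p = 1≤p G
  ; p<a = p<a′
  ; a≤b = a≤b H
  ; b≤n = b≤n H
  ; above = λ x∈ → interval H (p∈ G) (good-∉ G H) z∈′ x∈ (above G z∈)
  ; left = λ m∈ m<p → proj₁ (left G m∈ m<p) , λ x∈ →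
      interval H m∈ (λ (a′≤m , _) → <⇒≱ (<-trans m<p p<a′) a′≤m) z∈′ x∈ (proj₂ (left G m∈ m<p) z∈)
  -- A point beyond `b′` is beyond `z`, hence in the first block or to the right of it.
  ; right = λ {m} m∈ b′<m → case m ∈[ _ , _ ]? of λ where
      (yes m∈ab) → above G m∈ab
      (no m∉ab) → [ (λ m<a → contradiction (<-trans b′<m (<-≤-trans m<a (proj₁ z∈))) (≤⇒≯ (proj₂ z∈′)))
                  , right G m∈ ]′ (∉-cases m∉ab)
  ; interval = interval H
  }
  where p<a′ = good-before G H z∈ z∈′

-- On either side of `z`, the interval that reaches further contains everything.
∪-cases : z ∈[ a , b ] → z ∈[ a′ , b′ ] → x ∈[ a ⊓ a′ , b ⊔ b′ ] → x ∈[ a , b ] ⊎ x ∈[ a′ , b′ ]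
∪-cases {z} {a} {b} {a′} {b′} {x} (a≤z , z≤b) (a′≤z , z≤b′) (l , u) with x ≤? z
... | yes x≤z with ⊓-sel a a′
...   | inj₁ e = inj₁ (≤-trans (≤-reflexive (sym e)) l , ≤-trans x≤z z≤b)
...   | inj₂ e = inj₂ (≤-trans (≤-reflexive (sym e)) l , ≤-trans x≤z z≤b′)
∪-cases {z} {a} {b} {a′} {b′} {x} (a≤z , z≤b) (a′≤z , z≤b′) (l , u) | no x≰z with ⊔-sel b b′
...   | inj₁ e = inj₁ (≤-trans a≤z (≰⇒≥ x≰z) , ≤-trans u (≤-reflexive e))
...   | inj₂ e = inj₂ (≤-trans a′≤z (≰⇒≥ x≰z) , ≤-trans u (≤-reflexive e))

good-∪ : Good f n p a b → Good f n q a′ b′ → z ∈[ a , b ] → z ∈[ a′ , b′ ] →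
         Good f n p (a ⊓ a′) (b ⊔ b′)
good-∪ {f = f} {n} {a = a} {b} {a′ = a′} {b′} {z} G H z∈ z∈′ = record
  { 1≤p = 1≤p G
  ; p<a = ⊓-glb (p<a G) (p<a K)
  ; a≤b = ≤-trans (m⊓n≤m a a′) (≤-trans (a≤b G) (m≤m⊔n b b′))
  ; b≤n = ⊔-lub (b≤n G) (b≤n H)
  ; above = λ x∈ → [ above G , above K ]′ (cases x∈)
  ; left = λ m∈ m<p → proj₁ (left G m∈ m<p) , λ x∈ →
      [ proj₂ (left G m∈ m<p) , proj₂ (left K m∈ m<p) ]′ (cases x∈)
  ; right = λ m∈ b<m → right G m∈ (≤-<-trans (m≤m⊔n b b′) b<m)
  -- Two points of the union are compared through `z`, which shares a block with each of them.
  ; interval = λ m∈ m∉ x∈ y∈ → fromz m∈ m∉ y∈ ∘ toz m∈ m∉ x∈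
  }
  where
  K = good-transfer G H z∈ z∈′
  cases : x ∈[ a ⊓ a′ , b ⊔ b′ ] → x ∈[ a , b ] ⊎ x ∈[ a′ , b′ ]
  cases = ∪-cases z∈ z∈′
  ⊆ˡ : ∀ {m} → m ∈[ a , b ] → m ∈[ a ⊓ a′ , b ⊔ b′ ]
  ⊆ˡ (l , u) = ≤-trans (m⊓n≤m a a′) l , ≤-trans u (m≤m⊔n b b′)
  ⊆ʳ : ∀ {m} → m ∈[ a′ , b′ ] → m ∈[ a ⊓ a′ , b ⊔ b′ ]
  ⊆ʳ (l , u) = ≤-trans (m⊓n≤n a a′) l , ≤-trans u (m≤n⊔m b b′)
  toz : ∀ {m} → m ∈[ 1 , n ] → ¬ m ∈[ a ⊓ a′ , b ⊔ b′ ] → x ∈[ a ⊓ a′ , b ⊔ b′ ] → f m < f x → f m < f z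
  toz m∈ m∉ x∈ with cases x∈
  ... | inj₁ i = interval G m∈ (m∉ ∘ ⊆ˡ) i z∈
  ... | inj₂ i = interval H m∈ (m∉ ∘ ⊆ʳ) i z∈′
  fromz : ∀ {m} → m ∈[ 1 , n ] → ¬ m ∈[ a ⊓ a′ , b ⊔ b′ ] → x ∈[ a ⊓ a′ , b ⊔ b′ ] → f m < f z → f m < f x
  fromz m∈ m∉ x∈ with cases x∈
  ... | inj₁ i = interval G m∈ (m∉ ∘ ⊆ˡ) z∈ i
  ... | inj₂ i = interval H m∈ (m∉ ∘ ⊆ʳ) z∈′ i

-- Serves both `good-reverse` and `good-back`. The last hypothesis compares values instead of asking
-- for `b < ρ m`, because `ρ` may move a point right of the reversed block to the left of the
-- original one.
good-reindex : (∀ {m} → m ∈[ 1 , n ] → ρ m ∈[ 1 , n ]) → (∀ {m} → m ∈[ 1 , n ] → g m ≡ f (ρ m)) →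
  Good f n p a b → ρ p ≡ p → (∀ {m} → m ∈[ 1 , n ] → m < p → ρ m < p) →
  p < a′ → a′ ≤ b′ → b′ ≤ n →
  (∀ {x} → x ∈[ a′ , b′ ] → ρ x ∈[ a , b ]) →
  (∀ {m} → m ∈[ 1 , n ] → ¬ m ∈[ a′ , b′ ] → ¬ ρ m ∈[ a , b ]) →
  (∀ {m} → m ∈[ 1 , n ] → b′ < m → f p < f (ρ m)) →
  Good g n p a′ b′
good-reindex {n} {ρ} {g} {f} {p} {a′ = a′} {b′} ρ∈ gρ G ρp before p<a′ a′≤b′ b′≤n into outof after = record
  { 1≤p = 1≤p G
  ; p<a = p<a′
  ; a≤b = a′≤b′
  ; b≤n = b′≤n
  ; above = λ x∈ → to-g (p∈ G) (within x∈) (subst (λ t → f t < _) (sym ρp) (above G (into x∈)))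
  ; left = λ m∈ m<p → to-g (p∈ G) m∈ (subst (λ t → f t < _) (sym ρp) (proj₁ (left G (ρ∈ m∈) (before m∈ m<p))))
      , λ x∈ → to-g m∈ (within x∈) (proj₂ (left G (ρ∈ m∈) (before m∈ m<p)) (into x∈))
  ; right = λ m∈ b′<m → to-g (p∈ G) m∈ (subst (λ t → f t < _) (sym ρp) (after m∈ b′<m))
  ; interval = λ m∈ m∉ x∈ y∈ lt → to-g m∈ (within y∈)
      (interval G (ρ∈ m∈) (outof m∈ m∉) (into x∈) (into y∈) (subst₂ _<_ (gρ m∈) (gρ (within x∈)) lt))
  }
  where
  within : x ∈[ a′ , b′ ] → x ∈[ 1 , n ]
  within (a′≤x , x≤b′) = ≤-trans (1≤p G) (≤-trans (<⇒≤ p<a′) a′≤x) , ≤-trans x≤b′ b′≤n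
  to-g : ∀ {x y} → x ∈[ 1 , n ] → y ∈[ 1 , n ] → f (ρ x) < f (ρ y) → g x < g y
  to-g x∈ y∈ = subst₂ _<_ (sym (gρ x∈)) (sym (gρ y∈))

-- Maximal hot blocks and the reflection in them

record Max (f : ℕ → ℕ) (n a b : ℕ) : Set where
  field
    {pivot} : ℕ
    isGood  : Good f n pivot a b
    -- The competing block may have another pivot `q`: hot blocks that meet share their good points.
    maximal : Good f n q a′ b′ → z ∈[ a , b ] → z ∈[ a′ , b′ ] → a ≤ a′ × b′ ≤ b

open Max

data Turn (f : ℕ → ℕ) (n x r : ℕ) : Set where
  cold : (∀ {p a b} → Good f n p a b → ¬ x ∈[ a , b ]) → r ≡ x → Turn f n x r
  warm : Max f n a b → x ∈[ a , b ] → r + x ≡ a + b → Turn f n x r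

abstract
  -- The longest good block containing `x` is maximal: its union with a good block that meets it is
  -- again good, hence no longer. Later proofs rely on the `Turn` property alone, so the search
  -- stays abstract.
  turn : ∀ f n x → ∃ (Turn f n x)
  turn f n x with greatest
    -- A block is given by its start `a` and `L = b ∸ a`, so that the search maximises `L`.
    (λ L → ∃≤? (λ a → ∃≤? (λ p → good? f n p a (a + L) ×-dec (x ∈[ a , a + L ]?)) n) n) n
  ... | inj₂ none = x , cold (λ {p} {a} {b} G x∈ → none (≤-trans (m∸n≤m b a) (b≤n G))
          (a , ≤-trans (a≤b G) (b≤n G) , p , proj₂ (p∈ G) ,
           subst (λ t → Good f n p a t × x ∈[ a , t ]) (sym (m+[n∸m]≡n (a≤b G))) (G , x∈))) refl
  ... | inj₁ (L , (a , _ , p , _ , G , x∈) , longest) =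
          a + (a + L) ∸ x , warm (record { isGood = G ; maximal = max }) x∈
            (m∸n+n≡m (≤-trans (proj₂ x∈) (m≤n+m (a + L) a)))
    where
    max-at : Good f n q a′ b′ → x ∈[ a′ , b′ ] → a ≤ a′ × b′ ≤ a + L
    max-at {q} {a′} {b′} H x∈′ =
      -- The union spans at most `L`, which forces its ends to be `a` and `a + L`.
      ≤-trans (+-cancelʳ-≤ L a (a ⊓ a′) (≤-trans (m≤m⊔n (a + L) b′) short)) (m⊓n≤n a a′) ,
      ≤-trans (m≤n⊔m (a + L) b′) (≤-trans short (+-monoˡ-≤ L (m⊓n≤m a a′)))
      where
      K : Good f n p (a ⊓ a′) ((a + L) ⊔ b′)
      K = good-∪ G H x∈ x∈′
      short : (a + L) ⊔ b′ ≤ (a ⊓ a′) + L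
      short = ≤-trans (m≤n+m∸n _ (a ⊓ a′)) (+-monoʳ-≤ (a ⊓ a′) (longest (≤-trans (m∸n≤m _ (a ⊓ a′)) (b≤n K))
        (a ⊓ a′ , ≤-trans (a≤b K) (b≤n K) , p , proj₂ (p∈ G) ,
         subst (λ t → Good f n p (a ⊓ a′) t × x ∈[ a ⊓ a′ , t ]) (sym (m+[n∸m]≡n (a≤b K)))
           (K , ≤-trans (m⊓n≤m a a′) (proj₁ x∈) , ≤-trans (proj₂ x∈) (m≤m⊔n _ b′)))))
    -- The block of `H` need not contain `x`, but its union with that of `G` does.
    max : Good f n q a′ b′ → z ∈[ a , a + L ] → z ∈[ a′ , b′ ] → a ≤ a′ × b′ ≤ a + L
    max {a′ = a′} {b′} H z∈ z∈′ =
      let lo , hi = max-at (good-∪ G H z∈ z∈′) (≤-trans (m⊓n≤m a a′) (proj₁ x∈) , ≤-trans (proj₂ x∈) (m≤m⊔n _ b′))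
      in ≤-trans lo (m⊓n≤n a a′) , ≤-trans (m≤n⊔m (a + L) b′) hi

max-unique : Max f n a b → Max f n a′ b′ → z ∈[ a , b ] → z ∈[ a′ , b′ ] → a ≡ a′ × b ≡ b′
max-unique M M′ z∈ z∈′ =
  let a≤a′ , b′≤b = maximal M (isGood M′) z∈ z∈′
      a′≤a , b≤b′ = maximal M′ (isGood M) z∈′ z∈
  in ≤-antisym a≤a′ a′≤a , ≤-antisym b≤b′ b′≤b

module Turning {f : ℕ → ℕ} {n : ℕ} {ρ : ℕ → ℕ} (turns : ∀ {x} → x ∈[ 1 , n ] → Turn f n x (ρ x)) where

  ρ-mirror : Max f n a b → x ∈[ a , b ] → ρ x + x ≡ a + b
  ρ-mirror M x∈ with turns (inside (isGood M) x∈)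
  ... | cold c _ = contradiction x∈ (c (isGood M))
  ... | warm M′ x∈′ eq with max-unique M M′ x∈ x∈′
  ...   | refl , refl = eq

  ρ-∈ : x ∈[ 1 , n ] → ρ x ∈[ 1 , n ]
  ρ-∈ x∈ with turns x∈
  ... | cold _ eq = subst (_∈[ 1 , n ]) (sym eq) x∈
  ... | warm M x∈ab eq = inside (isGood M) (mirror-∈ eq x∈ab)

  ρ-involutive : x ∈[ 1 , n ] → ρ (ρ x) ≡ x
  ρ-involutive {x} x∈ with turns x∈
  ... | cold _ eq = trans (cong ρ eq) eq
  ... | warm M x∈ab eq = +-cancelʳ-≡ (ρ x) (ρ (ρ x)) x
        (trans (ρ-mirror M (mirror-∈ eq x∈ab)) (trans (sym eq) (+-comm (ρ x) x)))

  -- Only reflection in a maximal block moves a position, so everything passed on the way lies in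
  -- that block. Hence neither pivots nor ends of maximal blocks are crossed.
  crossing-up : x ∈[ 1 , n ] → x < y → y ≤ ρ x → ∃[ a ] ∃[ b ] Max f n a b × x ∈[ a , b ] × y ∈[ a , b ]
  crossing-up x∈ x<y y≤ρx with turns x∈
  ... | cold _ eq = contradiction (≤-trans y≤ρx (≤-reflexive eq)) (<⇒≱ x<y)
  ... | warm M x∈ab eq = _ , _ , M , x∈ab , ≤-trans (proj₁ x∈ab) (<⇒≤ x<y) , ≤-trans y≤ρx (proj₂ (mirror-∈ eq x∈ab))

  crossing-down : x ∈[ 1 , n ] → y < x → ρ x ≤ y → ∃[ a ] ∃[ b ] Max f n a b × x ∈[ a , b ] × y ∈[ a , b ]
  crossing-down x∈ y<x ρx≤y with turns x∈
  ... | cold _ eq = contradiction (≤-trans (≤-reflexive (sym eq)) ρx≤y) (<⇒≱ y<x)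
  ... | warm M x∈ab eq = _ , _ , M , x∈ab , ≤-trans (proj₁ (mirror-∈ eq x∈ab)) ρx≤y , ≤-trans (<⇒≤ y<x) (proj₂ x∈ab)

  ρ-pivot : Good f n p a b → ρ p ≡ p
  ρ-pivot G with turns (p∈ G)
  ... | cold _ eq = eq
  ... | warm M p∈ _ = contradiction p∈ (good-∉ G (isGood M))

  ρ-before : Good f n p a b → x ∈[ 1 , n ] → x < p → ρ x < p
  ρ-before G x∈ x<p = ≰⇒> λ p≤ρx →
    let _ , _ , M , _ , p∈ = crossing-up x∈ x<p p≤ρx in good-∉ G (isGood M) p∈

  ρ-after : Good f n p a b → x ∈[ 1 , n ] → p < x → p < ρ x
  ρ-after G x∈ p<x = ≰⇒> λ ρx≤p →
    let _ , _ , M , _ , p∈ = crossing-down x∈ p<x ρx≤p in good-∉ G (isGood M) p∈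

  hull : Good f n p a b → ∃[ c ] ∃[ d ] Max f n c d × c ≤ a × b ≤ d
  hull G with turns (inside G (≤-refl , a≤b G))
  ... | cold c _ = contradiction (≤-refl , a≤b G) (c G)
  ... | warm M a∈ _ = _ , _ , M , maximal M G a∈ (≤-refl , a≤b G)

  -- A good block lies in a maximal block `[c , d]`, its hull, and is carried by the reflection of
  -- the hull to `[ρ b , ρ a]`.
  module Reversed (G : Good f n p a b) where
    private
      c  = proj₁ (hull G)
      d  = proj₁ (proj₂ (hull G))
      M  = proj₁ (proj₂ (proj₂ (hull G)))
      c≤a = proj₁ (proj₂ (proj₂ (proj₂ (hull G))))
      b≤d = proj₂ (proj₂ (proj₂ (proj₂ (hull G))))

      widen : x ∈[ a , b ] → x ∈[ c , d ]
      widen (a≤x , x≤b) = ≤-trans c≤a a≤x , ≤-trans x≤b b≤d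

      a∈ : a ∈[ c , d ]
      a∈ = widen (≤-refl , a≤b G)
      b∈ : b ∈[ c , d ]
      b∈ = widen (a≤b G , ≤-refl)

      H : Good f n p c d
      H = good-transfer G (isGood M) (≤-refl , a≤b G) a∈

      sum : x ∈[ c , d ] → y ∈[ c , d ] → ρ x + x ≡ ρ y + y
      sum x∈ y∈ = trans (ρ-mirror M x∈) (sym (ρ-mirror M y∈))

      sum′ : x ∈[ c , d ] → y ∈[ c , d ] → x + ρ x ≡ ρ y + y
      sum′ {x} x∈ y∈ = trans (+-comm x (ρ x)) (sum x∈ y∈)

    ρb≤ρa : ρ b ≤ ρ a
    ρb≤ρa = +-antitone-≤ (sum a∈ b∈) (a≤b G)

    private
      narrow : x ∈[ ρ b , ρ a ] → x ∈[ c , d ]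
      narrow (l , u) = ≤-trans (proj₁ (mirror-∈ (ρ-mirror M b∈) b∈)) l , ≤-trans u (proj₂ (mirror-∈ (ρ-mirror M a∈) a∈))

    ρ-∈⁻ : x ∈[ ρ b , ρ a ] → ρ x ∈[ a , b ]
    ρ-∈⁻ x∈@(l , u) =
      +-antitone-≤ (sym (sum′ a∈ (narrow x∈))) u ,
      +-antitone-≤ (sum′ b∈ (narrow x∈)) l

    ρ-∈⁺ : x ∈[ a , b ] → ρ x ∈[ ρ b , ρ a ]
    ρ-∈⁺ x∈@(l , u) = +-antitone-≤ (sum (widen x∈) b∈) u , +-antitone-≤ (sum a∈ (widen x∈)) l

    ρ-∉ : x ∈[ 1 , n ] → ¬ x ∈[ ρ b , ρ a ] → ¬ ρ x ∈[ a , b ]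
    ρ-∉ x∈ x∉ ρx∈ = x∉ (subst (_∈[ ρ b , ρ a ]) (ρ-involutive x∈) (ρ-∈⁺ ρx∈))

    good-reverse : (∀ {m} → m ∈[ 1 , n ] → g m ≡ f (ρ m)) → Good g n p (ρ b) (ρ a)
    good-reverse gρ = good-reindex ρ-∈ gρ G (ρ-pivot G) (ρ-before G)
      (<-≤-trans (p<a H) (proj₁ (mirror-∈ (ρ-mirror M b∈) b∈)))
      ρb≤ρa
      (proj₂ (ρ-∈ (inside G (≤-refl , a≤b G))))
      ρ-∈⁻ ρ-∉ after
      where
      -- Points of the hull stay in it, hence above `p`. Points beyond `d` stay beyond `d`, since a
      -- maximal block reaching across `d` would contradict the maximality of the hull.
      after : x ∈[ 1 , n ] → ρ a < x → f p < f (ρ x)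
      after {x} x∈ ρa<x with x ∈[ c , d ]?
      ... | yes x∈cd = above H (mirror-∈ (ρ-mirror M x∈cd) x∈cd)
      ... | no x∉ = right H (ρ-∈ x∈) (≰⇒> λ ρx≤d →
              let _ , _ , M′ , x∈′ , d∈′ = crossing-down x∈ d<x ρx≤d
              in <⇒≱ d<x (≤-trans (proj₂ x∈′) (proj₂ (maximal M (isGood M′) (a≤b H , ≤-refl) d∈′))))
        where d<x = [ (λ x<c → contradiction (≤-trans (proj₁ (mirror-∈ (ρ-mirror M a∈) a∈)) (<⇒≤ ρa<x)) (<⇒≱ x<c)) , id ]′ (∉-cases x∉)

  module _ {g : ℕ → ℕ} (gρ : ∀ {m} → m ∈[ 1 , n ] → g m ≡ f (ρ m)) where

    -- Reflection exchanges the two ends of a maximal block, so `good-reverse` returns the block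
    -- itself.
    max-good : (M : Max f n a b) → Good g n (pivot M) a b
    max-good {a} {b} M = subst₂ (Good g n (pivot M)) ρb≡a ρa≡b (Reversed.good-reverse (isGood M) gρ)
      where
      ab = a≤b (isGood M)
      ρb≡a : ρ b ≡ a
      ρb≡a = +-cancelʳ-≡ b (ρ b) a (ρ-mirror M (ab , ≤-refl))
      ρa≡b : ρ a ≡ b
      ρa≡b = +-cancelʳ-≡ a (ρ a) b (trans (ρ-mirror M (≤-refl , ab)) (+-comm a b))

    -- The maximal blocks of f are good for g, so a maximal block of g is a union of
    -- maximal blocks of f and fixed points of ρ; hence ρ maps it to itself.
    good-back : (M : Max g n a b) → Good f n (pivot M) a b
    good-back {a} {b} M = good-reindex {ρ = ρ} ρ-∈ (λ m∈ → trans (sym (cong f (ρ-involutive m∈))) (sym (gρ (ρ-∈ m∈))))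
      G fixed before (p<a G) (a≤b G) (b≤n G) stable
      (λ m∈ m∉ ρm∈ → m∉ (subst (_∈[ a , b ]) (ρ-involutive m∈) (stable ρm∈)))
      -- A maximal block of `f` across `b` would be good for `g` and exceed the maximal block `M`.
      (λ m∈ b<m → right G (ρ-∈ m∈) (≰⇒> λ ρm≤b →
        let _ , _ , M′ , m∈′ , b∈′ = crossing-down m∈ b<m ρm≤b
        in <⇒≱ b<m (≤-trans (proj₂ m∈′) (proj₂ (maximal M (max-good M′) (a≤b G , ≤-refl) b∈′)))))
      where
      G = isGood M
      fixed : ρ (pivot M) ≡ pivot M
      fixed with turns (p∈ G)
      ... | cold _ eq = eq
      ... | warm M′ p∈ _ = contradiction p∈ (good-∉ G (max-good M′))
      before : x ∈[ 1 , n ] → x < pivot M → ρ x < pivot M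
      before x∈ x<p = ≰⇒> λ p≤ρx →
        let _ , _ , M′ , _ , p∈ = crossing-up x∈ x<p p≤ρx in good-∉ G (max-good M′) p∈
      stable : x ∈[ a , b ] → ρ x ∈[ a , b ]
      stable x∈ with turns (inside G x∈)
      ... | cold _ eq = subst (_∈[ a , b ]) (sym eq) x∈
      ... | warm M′ x∈′ eq =
        let a≤ , ≤b = maximal M (max-good M′) x∈ x∈′
            l , u = mirror-∈ eq x∈′
        in ≤-trans a≤ l , ≤-trans u ≤b

    -- Maximal blocks of `f` are good for `g` and conversely, so two that meet contain each other
    -- and have the same reflection. This is what makes block reversal an involution.
    turn-stable : x ∈[ 1 , n ] → Turn g n x r → r ≡ ρ x
    turn-stable x∈ (cold c eq) with turns x∈
    ... | cold _ eq′ = trans eq (sym eq′)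
    ... | warm M x∈ab _ = contradiction x∈ab (c (max-good M))
    turn-stable {x} {r} x∈ (warm M x∈ab eq) with turns x∈
    ... | cold c _ = contradiction x∈ab (c (good-back M))
    ... | warm M′ x∈′ eq′ =
      let a≤ , ≤b = maximal M (max-good M′) x∈ab x∈′
          ≤a , b≤ = maximal M′ (good-back M) x∈′ x∈ab
      in +-cancelʳ-≡ x r _ (trans eq (trans (cong₂ _+_ (≤-antisym a≤ ≤a) (≤-antisym b≤ ≤b)) (sym eq′)))

-- Occurrences of the two patterns and block reversal

data Shape : Set where
  inc dec : Shape

private
  variable
    s : Shape

opposite : Shape → Shape
opposite inc = dec
opposite dec = inc

pattern-of : Shape → List ℕ
pattern-of inc = p123
pattern-of dec = p132

-- The values in the roles of the letters 2 and 3 of the pattern.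
low high : Shape → (ℕ → ℕ) → ℕ → ℕ → ℕ
low  inc f j k = f j
low  dec f j k = f k
high inc f j k = f k
high dec f j k = f j

-- An occurrence under the shading `R1`; that the letter 1 is the lowest is part of `block`.
record Occurrence (s : Shape) (f : ℕ → ℕ) (n i j k : ℕ) : Set where
  constructor occurrence
  field
    block    : Good f n i j k
    low<high : low s f j k < high s f j k
    bounded  : ∀ {x} → x ∈[ j , k ] → f x ∈[ low s f j k , high s f j k ]

open Occurrence

-- Encodes box (2,2): by `bounded`, points between positions `j` and `k` have no other row to lie
-- in.
Adjacent : ℕ → ℕ → Set
Adjacent j k = ∀ {m} → j < m → ¬ m < k

-- Together with (1,2) and (3,2), the boxes (1,1), (1,3), (3,1), (3,3) shade columns 1 and 3
-- everywhere above the letter 1.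
Final : (ℕ → ℕ) → ℕ → ℕ → ℕ → ℕ → Set
Final f n i j k = ∀ {m} → m ∈[ 1 , n ] → i < m → ¬ m ∈[ j , k ] → f m < f i

low-attained : ∀ s → j ≤ k → ∃[ y ] y ∈[ j , k ] × low s f j k ≡ f y
low-attained inc j≤k = _ , (≤-refl , j≤k) , refl
low-attained dec j≤k = _ , (j≤k , ≤-refl) , refl

high-attained : ∀ s → j ≤ k → ∃[ y ] y ∈[ j , k ] × high s f j k ≡ f y
high-attained inc j≤k = _ , (j≤k , ≤-refl) , refl
high-attained dec j≤k = _ , (≤-refl , j≤k) , refl

-- Exchanging the patterns undoes exchanging the ends of the block.
low-opposite : ∀ s → low (opposite s) f j k ≡ low s f k j
low-opposite inc = refl
low-opposite dec = refl

high-opposite : ∀ s → high (opposite s) f j k ≡ high s f k j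
high-opposite inc = refl
high-opposite dec = refl

low-cong : ∀ s → g j ≡ f x → g k ≡ f y → low s g j k ≡ low s f x y
low-cong inc p q = p
low-cong dec p q = q

high-cong : ∀ s → g j ≡ f x → g k ≡ f y → high s g j k ≡ high s f x y
high-cong inc p q = q
high-cong dec p q = p

low<high⇒j<k : ∀ s → j ≤ k → low s f j k < high s f j k → j < k
low<high⇒j<k inc j≤k lt = ≤∧≢⇒< j≤k λ { refl → <-irrefl refl lt }
low<high⇒j<k dec j≤k lt = ≤∧≢⇒< j≤k λ { refl → <-irrefl refl lt }

module Reversal {f : ℕ → ℕ} {n : ℕ} {ρ : ℕ → ℕ} (turns : ∀ {x} → x ∈[ 1 , n ] → Turn f n x (ρ x))
                {g : ℕ → ℕ} (gρ : ∀ {m} → m ∈[ 1 , n ] → g m ≡ f (ρ m)) where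
  open Turning turns

  -- `g` has at `ρ k` and `ρ j` the values of `f` at `k` and `j`, so the ends are swapped while the
  -- set of values in the block is kept.
  occurrence-reverse : ∀ s → Occurrence s f n i j k → Occurrence (opposite s) g n i (ρ k) (ρ j)
  occurrence-reverse {i} {j} {k} s (occurrence G lt bd) = occurrence G′ (subst₂ _<_ (sym low≡) (sym high≡) lt)
    λ x∈ → subst₂ (_ ∈[_,_]) (sym low≡) (sym high≡)
             (subst (_∈[ _ , _ ]) (sym (gρ (inside G′ x∈))) (bd (R.ρ-∈⁻ x∈)))
    where
    module R = Reversed G
    G′ = R.good-reverse gρ
    at-ρ : ∀ {x} → x ∈[ j , k ] → g (ρ x) ≡ f x
    at-ρ x∈ = trans (gρ (ρ-∈ (inside G x∈))) (cong f (ρ-involutive (inside G x∈)))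
    gρj = at-ρ (≤-refl , a≤b G)
    gρk = at-ρ (a≤b G , ≤-refl)
    low≡ : low (opposite s) g (ρ k) (ρ j) ≡ low s f j k
    low≡ = trans (low-opposite s) (low-cong s gρj gρk)
    high≡ : high (opposite s) g (ρ k) (ρ j) ≡ high s f j k
    high≡ = trans (high-opposite s) (high-cong s gρj gρk)

  -- `ρ` takes a position strictly inside the reversed block to one inside the original block, and
  -- not to its ends because `ρ` is an involution.
  adjacent-reverse : Good f n i j k → Adjacent j k → Adjacent (ρ k) (ρ j)
  adjacent-reverse {i} {j} {k} G adj {m} ρk<m m<ρj =
    adj (≤∧≢⇒< (proj₁ ρm∈) λ j≡ρm → <-irrefl (trans (sym ρρm) (cong ρ (sym j≡ρm))) m<ρj)
        (≤∧≢⇒< (proj₂ ρm∈) λ ρm≡k → <-irrefl (trans (cong ρ (sym ρm≡k)) ρρm) ρk<m)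
    where
    m∈ρ = <⇒≤ ρk<m , <⇒≤ m<ρj
    ρm∈ = Reversed.ρ-∈⁻ G m∈ρ
    ρρm : ρ (ρ m) ≡ m
    ρρm = ρ-involutive (≤-trans (proj₁ (ρ-∈ (inside G (a≤b G , ≤-refl)))) (proj₁ m∈ρ) ,
                        ≤-trans (proj₂ m∈ρ) (proj₂ (ρ-∈ (inside G (≤-refl , a≤b G)))))

  -- Position `i` is fixed, later positions stay later, and those outside the reversed block go
  -- outside the original one.
  final-reverse : Good f n i j k → Final f n i j k → Final g n i (ρ k) (ρ j)
  final-reverse G fin m∈ i<m m∉ =
    subst₂ _<_ (sym (gρ m∈)) (sym (trans (gρ (p∈ G)) (cong f (ρ-pivot G))))
      (fin (ρ-∈ m∈) (ρ-after G m∈ i<m) (Reversed.ρ-∉ G m∈ m∉))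

-- The four shadings

-- α and φ say whether R also shades box (2,2), respectively (1,1), (1,3), (3,1), (3,3).
Shading : Bool → Bool → List (ℕ × ℕ) → Set₁
Shading α φ R = (P : ℕ × ℕ → Set) →
  All P R ⇔ (All P R1 × (T α → P (2 , 2)) × (T φ → P (1 , 1) × P (1 , 3) × P (3 , 1) × P (3 , 3)))

shading₁ : Shading false false R1
shading₁ P = mk⇔ (λ b → b , (λ ()) , λ ()) proj₁

shading₂ : Shading true false R2
shading₂ P = mk⇔
  (λ { (b₀ ∷ b₁ ∷ b₂ ∷ b₃ ∷ b₄ ∷ b₅ ∷ b₂₂ ∷ bs) → b₀ ∷ b₁ ∷ b₂ ∷ b₃ ∷ b₄ ∷ b₅ ∷ bs , (λ _ → b₂₂) , λ () })
  (λ { (b₀ ∷ b₁ ∷ b₂ ∷ b₃ ∷ b₄ ∷ b₅ ∷ bs , b₂₂ , _) → b₀ ∷ b₁ ∷ b₂ ∷ b₃ ∷ b₄ ∷ b₅ ∷ b₂₂ tt ∷ bs })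

shading₃ : Shading false true R3
shading₃ P = mk⇔
  (λ { (b₀ ∷ b₁ ∷ b₂ ∷ b₁₁ ∷ b₃ ∷ b₁₃ ∷ b₄ ∷ b₅ ∷ b₆ ∷ b₇ ∷ b₃₁ ∷ b₈ ∷ b₃₃ ∷ []) →
       b₀ ∷ b₁ ∷ b₂ ∷ b₃ ∷ b₄ ∷ b₅ ∷ b₆ ∷ b₇ ∷ b₈ ∷ [] , (λ ()) , λ _ → b₁₁ , b₁₃ , b₃₁ , b₃₃ })
  (λ { (b₀ ∷ b₁ ∷ b₂ ∷ b₃ ∷ b₄ ∷ b₅ ∷ b₆ ∷ b₇ ∷ b₈ ∷ [] , _ , bs) → case bs tt of λ { (b₁₁ , b₁₃ , b₃₁ , b₃₃) →
       b₀ ∷ b₁ ∷ b₂ ∷ b₁₁ ∷ b₃ ∷ b₁₃ ∷ b₄ ∷ b₅ ∷ b₆ ∷ b₇ ∷ b₃₁ ∷ b₈ ∷ b₃₃ ∷ [] } })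

shading₄ : Shading true true R4
shading₄ P = mk⇔
  (λ { (b₀ ∷ b₁ ∷ b₂ ∷ b₁₁ ∷ b₃ ∷ b₁₃ ∷ b₄ ∷ b₅ ∷ b₂₂ ∷ b₆ ∷ b₇ ∷ b₃₁ ∷ b₈ ∷ b₃₃ ∷ []) →
       b₀ ∷ b₁ ∷ b₂ ∷ b₃ ∷ b₄ ∷ b₅ ∷ b₆ ∷ b₇ ∷ b₈ ∷ [] , (λ _ → b₂₂) , λ _ → b₁₁ , b₁₃ , b₃₁ , b₃₃ })
  (λ { (b₀ ∷ b₁ ∷ b₂ ∷ b₃ ∷ b₄ ∷ b₅ ∷ b₆ ∷ b₇ ∷ b₈ ∷ [] , b₂₂ , bs) → case bs tt of λ { (b₁₁ , b₁₃ , b₃₁ , b₃₃) →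
       b₀ ∷ b₁ ∷ b₂ ∷ b₁₁ ∷ b₃ ∷ b₁₃ ∷ b₄ ∷ b₅ ∷ b₂₂ tt ∷ b₆ ∷ b₇ ∷ b₃₁ ∷ b₈ ∷ b₃₃ ∷ [] } })

∈-range1⁺ : x ∈[ 1 , n ] → x ∈ range1 n
∈-range1⁺ {suc x} (_ , x<n) = ∈-applyUpTo⁺ suc x<n

∈-range1⁻ : x ∈ range1 n → x ∈[ 1 , n ]
∈-range1⁻ x∈ with ∈-applyUpTo⁻ suc x∈
... | _ , i<n , refl = s≤s z≤n , i<n

-- Mesh occurrences in terms of blocks

-- `vs` is a parameter so that the sorted list can be replaced by explicit letters once the order of
-- the three values is known.
Empty : (ℕ → ℕ) → ℕ → List ℕ → List ℕ → ℕ × ℕ → Set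
Empty f n is vs (a , b) = ∀ {m} → m ∈[ 1 , n ] → ext n is a < m → m < ext n is (suc a) →
  ext n vs b < f m → ¬ f m < ext n vs (suc b)

T-not : ∀ {b} → T (not b) ⇔ (¬ T b)
T-not {true}  = mk⇔ (λ ()) (λ h → h tt)
T-not {false} = mk⇔ (λ _ ()) (λ _ → tt)

boxEmpty⇔ : ∀ n π is ab → T (boxEmpty n π is ab) ⇔ Empty (at π) n is (sort (map (at π) is)) ab
boxEmpty⇔ n π is (a , b) = mk⇔ {B = Empty (at π) n is (sort (map (at π) is)) (a , b)}
  (λ t m∈ h₁ h₂ h₃ h₄ → to T-not t (any⁺ _ (lose (∈-range1⁺ m∈)
    (from T-∧ (<⇒<ᵇ h₁ , from T-∧ (<⇒<ᵇ h₂ , from T-∧ (<⇒<ᵇ h₃ , <⇒<ᵇ h₄)))))))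
  (from T-not ∘ none)
  where
  none : Empty (at π) n is (sort (map (at π) is)) (a , b) → ¬ T (any _ (range1 n))
  none e t with find (any⁻ _ (range1 n) t)
  ... | m , m∈ , c =
    let c₁ , c′ = to T-∧ c ; c₂ , c″ = to T-∧ c′ ; c₃ , c₄ = to T-∧ c″
    in e {m} (∈-range1⁻ m∈) (<ᵇ⇒< _ m c₁) (<ᵇ⇒< m _ c₂) (<ᵇ⇒< _ (at π m) c₃) (<ᵇ⇒< (at π m) _ c₄)

<ᵇ-true : x < y → (x <ᵇ y) ≡ true
<ᵇ-true = to T-≡ ∘ <⇒<ᵇ

<ᵇ-false : y ≤ x → (x <ᵇ y) ≡ false
<ᵇ-false {y} {x} y≤x = ¬-not λ e → ≤⇒≯ y≤x (<ᵇ⇒< x y (from T-≡ e))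

sort-123 : x < y → y < z → sort (x ∷ y ∷ z ∷ []) ≡ x ∷ y ∷ z ∷ []
sort-123 x<y y<z rewrite <ᵇ-true y<z | <ᵇ-true x<y = refl

sort-132 : x < z → z < y → sort (x ∷ y ∷ z ∷ []) ≡ x ∷ z ∷ y ∷ []
sort-132 x<z z<y rewrite <ᵇ-false (<⇒≤ z<y) | <ᵇ-true x<z = refl

orderIso-cell : ∀ xs ys → T (orderIso xs ys) → ∀ {a b} → a ∈ range1 (length xs) → b ∈ range1 (length xs) →
  at ys a < at ys b → at xs a < at xs b
orderIso-cell xs ys t {a} {b} a∈ b∈ lt
  with to T-∨ (All.lookup (all⁺ _ _ (All.lookup (all⁺ _ _ (proj₂ (to (T-∧ {length xs ≡ᵇ length ys}) t))) a∈)) b∈)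
... | inj₁ c = <ᵇ⇒< _ _ (proj₁ (to (T-∧ {at xs a <ᵇ at xs b}) c))
... | inj₂ c = contradiction (<⇒<ᵇ lt) (to T-not (proj₂ (to (T-∧ {not (at xs a <ᵇ at xs b)}) c)))

orderIso-123 : T (orderIso (x ∷ y ∷ z ∷ []) p123) ⇔ (x < y × y < z)
orderIso-123 {x} {y} {z} = mk⇔
  (λ t → orderIso-cell (x ∷ y ∷ z ∷ []) p123 t (here refl) (there (here refl)) (s≤s (s≤s z≤n))
       , orderIso-cell (x ∷ y ∷ z ∷ []) p123 t (there (here refl)) (there (there (here refl))) (s≤s (s≤s (s≤s z≤n))))
  λ (x<y , y<z) → sound x<y y<z
  where
  sound : x < y → y < z → T (orderIso (x ∷ y ∷ z ∷ []) p123)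
  sound x<y y<z
    -- All nine comparisons, the diagonal included, are settled so that the Boolean test computes.
    rewrite <ᵇ-true x<y | <ᵇ-true y<z | <ᵇ-true (<-trans x<y y<z)
          | <ᵇ-false (<⇒≤ x<y) | <ᵇ-false (<⇒≤ y<z) | <ᵇ-false (<⇒≤ (<-trans x<y y<z))
          | <ᵇ-false (≤-refl {x}) | <ᵇ-false (≤-refl {y}) | <ᵇ-false (≤-refl {z}) = tt

orderIso-132 : T (orderIso (x ∷ y ∷ z ∷ []) p132) ⇔ (x < z × z < y)
orderIso-132 {x} {y} {z} = mk⇔
  (λ t → orderIso-cell (x ∷ y ∷ z ∷ []) p132 t (here refl) (there (there (here refl))) (s≤s (s≤s z≤n))
       , orderIso-cell (x ∷ y ∷ z ∷ []) p132 t (there (there (here refl))) (there (here refl)) (s≤s (s≤s (s≤s z≤n))))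
  λ (x<z , z<y) → sound x<z z<y
  where
  sound : x < z → z < y → T (orderIso (x ∷ y ∷ z ∷ []) p132)
  sound x<z z<y
    rewrite <ᵇ-true x<z | <ᵇ-true z<y | <ᵇ-true (<-trans x<z z<y)
          | <ᵇ-false (<⇒≤ x<z) | <ᵇ-false (<⇒≤ z<y) | <ᵇ-false (<⇒≤ (<-trans x<z z<y))
          | <ᵇ-false (≤-refl {x}) | <ᵇ-false (≤-refl {y}) | <ᵇ-false (≤-refl {z}) = tt

orderIso⇔ : ∀ s → T (orderIso (f i ∷ f j ∷ f k ∷ []) (pattern-of s)) ⇔ (f i < low s f j k × low s f j k < high s f j k)
orderIso⇔ inc = orderIso-123
orderIso⇔ dec = orderIso-132

sort-shape : ∀ s → f i < low s f j k → low s f j k < high s f j k →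
  sort (f i ∷ f j ∷ f k ∷ []) ≡ f i ∷ low s f j k ∷ high s f j k ∷ []
sort-shape inc = sort-123
sort-shape dec = sort-132

-- The order condition is extracted first, since it determines the sorted list that the boxes refer
-- to.
isOcc⇔ : ∀ s R n π → T (isOcc (mesh (pattern-of s) R) n π (i ∷ j ∷ k ∷ [])) ⇔
  ((at π i < low s (at π) j k × low s (at π) j k < high s (at π) j k) ×
   All (Empty (at π) n (i ∷ j ∷ k ∷ []) (at π i ∷ low s (at π) j k ∷ high s (at π) j k ∷ [])) R)
isOcc⇔ {i} {j} {k} s R n π = mk⇔
  (λ t → let o , b = to (T-∧ {orderIso (at π i ∷ at π j ∷ at π k ∷ []) (pattern-of s)}) t
             o₁ , o₂ = to (orderIso⇔ s) o
         in (o₁ , o₂) , subst (λ vs → All (Empty (at π) n ijk vs) R) (sort-shape {f = at π} s o₁ o₂)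
              (All.map (λ {ab} → to (boxEmpty⇔ n π ijk ab)) (all⁺ (boxEmpty n π ijk) R b)))
  (λ ((o₁ , o₂) , b) → from T-∧ (from (orderIso⇔ s) (o₁ , o₂) ,
     all⁻ (boxEmpty n π ijk) (All.map (λ {ab} → from (boxEmpty⇔ n π ijk ab))
       (subst (λ vs → All (Empty (at π) n ijk vs) R) (sym (sort-shape {f = at π} s o₁ o₂)) b))))
  where ijk = i ∷ j ∷ k ∷ []

-- `values` keeps all points strictly between the border values 0 and `suc n`; `injective` keeps
-- other points off the lines that bound the open boxes.
record Permutes (f : ℕ → ℕ) (n : ℕ) : Set where
  field
    values    : x ∈[ 1 , n ] → f x ∈[ 1 , n ]
    injective : x ∈[ 1 , n ] → y ∈[ 1 , n ] → f x ≡ f y → x ≡ y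

open Permutes

module Boxes {f : ℕ → ℕ} {n : ℕ} (perm : Permutes f n) (s : Shape) {i j k : ℕ}
             (1≤i : 1 ≤ i) (i<j : i < j) (j<k : j < k) (k≤n : k ≤ n) where
  private
    u = f i
    v = low s f j k
    w = high s f j k
    E = Empty f n (i ∷ j ∷ k ∷ []) (u ∷ v ∷ w ∷ [])

    j≤k : j ≤ k
    j≤k = <⇒≤ j<k
    i<k : i < k
    i<k = <-trans i<j j<k
    i∈ : i ∈[ 1 , n ]
    i∈ = 1≤i , ≤-trans (<⇒≤ i<k) k≤n
    in-block : x ∈[ j , k ] → x ∈[ 1 , n ]
    in-block (l , r) = ≤-trans 1≤i (≤-trans (<⇒≤ i<j) l) , ≤-trans r k≤n
    0<f : m ∈[ 1 , n ] → 0 < f m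
    0<f m∈ = proj₁ (values perm m∈)
    f<1+n : m ∈[ 1 , n ] → f m < suc n
    f<1+n m∈ = s≤s (proj₂ (values perm m∈))

    ≢u : m ∈[ 1 , n ] → m ≢ i → f m ≢ u
    ≢u m∈ m≢i eq = m≢i (injective perm m∈ i∈ eq)
    ≢v : m ∈[ 1 , n ] → ¬ m ∈[ j , k ] → f m ≢ v
    ≢v m∈ m∉ eq with low-attained {f = f} s j≤k
    ... | y , y∈ , v≡fy with injective perm m∈ (in-block y∈) (trans eq v≡fy)
    ...   | refl = m∉ y∈
    ≢w : m ∈[ 1 , n ] → ¬ m ∈[ j , k ] → f m ≢ w
    ≢w m∈ m∉ eq with high-attained {f = f} s j≤k
    ... | y , y∈ , w≡fy with injective perm m∈ (in-block y∈) (trans eq w≡fy)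
    ...   | refl = m∉ y∈

    endpoints : ∀ {P : ℕ → Set} s → P (low s f j k) → P (high s f j k) → P (f j) × P (f k)
    endpoints inc p q = p , q
    endpoints dec p q = q , p

    before-∉ : m < j → ¬ m ∈[ j , k ]
    before-∉ m<j (j≤m , _) = <⇒≱ m<j j≤m
    after-∉ : k < m → ¬ m ∈[ j , k ]
    after-∉ k<m (_ , m≤k) = <⇒≱ k<m m≤k

  -- (2,0), (2,1), (2,3) confine the block to `[v , w]`; (0,0), (0,2), (0,3) give `left`; (3,0)
  -- gives `right`; and (0,2), (1,2), (3,2) keep other points out of the rows of the block, which is
  -- `interval`.
  boxes⇒occurrence : u < v → v < w → All E R1 → Occurrence s f n i j k
  boxes⇒occurrence u<v v<w (b₀₀ ∷ b₀₂ ∷ b₀₃ ∷ b₁₂ ∷ b₂₀ ∷ b₂₁ ∷ b₂₃ ∷ b₃₀ ∷ b₃₂ ∷ []) =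
    occurrence (record
      { 1≤p = 1≤i ; p<a = i<j ; a≤b = j≤k ; b≤n = k≤n
      ; above = λ x∈ → <-≤-trans u<v (proj₁ (bd x∈))
      ; left = λ m∈ m<i → left-u m∈ m<i , λ x∈ → <-≤-trans (left-v m∈ m<i) (proj₁ (bd x∈))
      ; right = λ {m} m∈ k<m → ≤∧≢⇒< (≮⇒≥ λ fm<u → b₃₀ m∈ k<m (s≤s (proj₂ m∈)) (0<f m∈) fm<u)
                             (≢u m∈ (λ { refl → <-asym k<m i<k }) ∘ sym)
      ; interval = λ m∈ m∉ x∈ y∈ fm<fx → <-≤-trans (below-v m∈ m∉ (<-≤-trans fm<fx (proj₂ (bd x∈)))) (proj₁ (bd y∈))
      }) v<w bd
    where
    strictly : j < x → x < k → f x ∈[ v , w ]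
    strictly {x} j<x x<k =
      ≮⇒≥ (λ fx<v → case <-cmp (f x) u of λ where
        (tri< fx<u _ _) → b₂₀ x∈ j<x x<k (0<f x∈) fx<u
        (tri≈ _ eq _) → ≢u x∈ (λ { refl → <-asym i<j j<x }) eq
        (tri> _ _ u<fx) → b₂₁ x∈ j<x x<k u<fx fx<v) ,
      ≮⇒≥ λ w<fx → b₂₃ x∈ j<x x<k w<fx (f<1+n x∈)
      where x∈ = in-block (<⇒≤ j<x , <⇒≤ x<k)
    ends : f j ∈[ v , w ] × f k ∈[ v , w ]
    ends = endpoints {_∈[ v , w ]} s (≤-refl , <⇒≤ v<w) (<⇒≤ v<w , ≤-refl)
    bd : x ∈[ j , k ] → f x ∈[ v , w ]
    bd (j≤x , x≤k) with m≤n⇒m<n∨m≡n j≤x | m≤n⇒m<n∨m≡n x≤k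
    ... | inj₂ refl | _ = proj₁ ends
    ... | inj₁ _ | inj₂ refl = proj₂ ends
    ... | inj₁ j<x | inj₁ x<k = strictly j<x x<k
    left-u : m ∈[ 1 , n ] → m < i → u < f m
    left-u m∈ m<i = ≤∧≢⇒< (≮⇒≥ λ fm<u → b₀₀ m∈ (proj₁ m∈) m<i (0<f m∈) fm<u) (≢u m∈ (<⇒≢ m<i) ∘ sym)
    left-v : m ∈[ 1 , n ] → m < i → f m < v
    left-v m∈ m<i = ≰⇒> λ v≤fm → case <-cmp (f _) w of λ where
        (tri< fm<w _ _) → b₀₂ m∈ (proj₁ m∈) m<i (≤∧≢⇒< v≤fm (≢v m∈ m∉ ∘ sym)) fm<w
        (tri≈ _ eq _) → ≢w m∈ m∉ eq
        (tri> _ _ w<fm) → b₀₃ m∈ (proj₁ m∈) m<i w<fm (f<1+n m∈)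
      where m∉ = before-∉ (<-trans m<i i<j)
    below-v : m ∈[ 1 , n ] → ¬ m ∈[ j , k ] → f m < w → f m < v
    below-v {m} m∈ m∉ fm<w = ≰⇒> λ v≤fm →
      let v<fm = ≤∧≢⇒< v≤fm (≢v m∈ m∉ ∘ sym) in
      case ∉-cases m∉ of λ where
        (inj₂ k<m) → b₃₂ m∈ k<m (s≤s (proj₂ m∈)) v<fm fm<w
        (inj₁ m<j) → case <-cmp m i of λ where
          (tri< m<i _ _) → b₀₂ m∈ (proj₁ m∈) m<i v<fm fm<w
          (tri≈ _ refl _) → <-asym u<v v<fm
          (tri> _ _ i<m) → b₁₂ m∈ i<m m<j v<fm fm<w

  occurrence⇒u<v : Occurrence s f n i j k → u < v
  occurrence⇒u<v o with low-attained {f = f} s j≤k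
  ... | y , y∈ , eq = subst (u <_) (sym eq) (above (block o) y∈)

  occurrence⇒boxes : Occurrence s f n i j k → All E R1
  occurrence⇒boxes o@(occurrence G v<w bd) =
      (λ m∈ _ m<i _ fm<u → <-asym fm<u (proj₁ (left G m∈ m<i)))
    ∷ (λ m∈ _ m<i v<fm _ → <-asym v<fm (left-v m∈ m<i))
    ∷ (λ m∈ _ m<i w<fm _ → <-asym (<-trans v<w w<fm) (left-v m∈ m<i))
    ∷ (λ m∈ i<m m<j → outside m∈ (before-∉ m<j))
    ∷ (λ m∈ j<m m<k _ fm<u → <⇒≱ (<-trans fm<u u<v) (proj₁ (bd (<⇒≤ j<m , <⇒≤ m<k))))
    ∷ (λ m∈ j<m m<k _ fm<v → <⇒≱ fm<v (proj₁ (bd (<⇒≤ j<m , <⇒≤ m<k))))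
    ∷ (λ m∈ j<m m<k w<fm _ → <⇒≱ w<fm (proj₂ (bd (<⇒≤ j<m , <⇒≤ m<k))))
    ∷ (λ m∈ k<m _ _ fm<u → <-asym fm<u (right G m∈ k<m))
    ∷ (λ m∈ k<m _ → outside m∈ (after-∉ k<m))
    ∷ []
    where
    u<v = occurrence⇒u<v o
    vy = low-attained {f = f} s j≤k
    wy = high-attained {f = f} s j≤k
    left-v : m ∈[ 1 , n ] → m < i → f m < v
    left-v m∈ m<i = subst (_ <_) (sym (proj₂ (proj₂ vy))) (proj₂ (left G m∈ m<i) (proj₁ (proj₂ vy)))
    -- Both `v` and `w` are attained in the block, so by `interval` a point below `w` is below `v`.
    outside : m ∈[ 1 , n ] → ¬ m ∈[ j , k ] → v < f m → ¬ f m < w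
    outside m∈ m∉ v<fm fm<w = <-asym v<fm (subst (_ <_) (sym (proj₂ (proj₂ vy)))
      (interval G m∈ m∉ (proj₁ (proj₂ wy)) (proj₁ (proj₂ vy)) (subst (_ <_) (proj₂ (proj₂ wy)) fm<w)))

  -- By injectivity, a point strictly between `j` and `k` has its value strictly between `v` and
  -- `w`, hence lies in box (2,2).
  adjacent⇔box : Occurrence s f n i j k → E (2 , 2) ⇔ Adjacent j k
  adjacent⇔box (occurrence G v<w bd) = mk⇔ {A = E (2 , 2)} {B = Adjacent j k}
    (λ b₂₂ j<m m<k →
      let m∈ = (<⇒≤ j<m , <⇒≤ m<k)
          ≢j = λ e → <-irrefl (injective perm (in-block (≤-refl , j≤k)) (in-block m∈) e) j<m
          ≢k = λ e → <-irrefl (injective perm (in-block m∈) (in-block (j≤k , ≤-refl)) (sym e)) m<k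
          ≢v′ , ≢w′ = extremes s ≢j ≢k
      in b₂₂ (in-block m∈) j<m m<k (≤∧≢⇒< (proj₁ (bd m∈)) ≢v′) (≤∧≢⇒< (proj₂ (bd m∈)) (≢w′ ∘ sym)))
    (λ adj _ j<m m<k → contradiction m<k (adj j<m))
    where
    extremes : ∀ s → f j ≢ x → f k ≢ x → low s f j k ≢ x × high s f j k ≢ x
    extremes inc p q = p , q
    extremes dec p q = q , p

  -- A later point outside the block and above `u` lies in column 1 or 3 and in one of the rows 1 to
  -- 3; `R1` supplies (1,2) and (3,2).
  final⇔boxes : u < v → v < w → All E R1 → (E (1 , 1) × E (1 , 3) × E (3 , 1) × E (3 , 3)) ⇔ Final f n i j k
  final⇔boxes u<v v<w (_ ∷ _ ∷ _ ∷ b₁₂ ∷ _ ∷ _ ∷ _ ∷ _ ∷ b₃₂ ∷ []) = mk⇔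
    {A = E (1 , 1) × E (1 , 3) × E (3 , 1) × E (3 , 3)} {B = Final f n i j k}
    (λ (b₁₁ , b₁₃ , b₃₁ , b₃₃) m∈ i<m m∉ → ≰⇒> λ u≤fm →
      let u<fm = ≤∧≢⇒< u≤fm (≢u m∈ (>⇒≢ i<m) ∘ sym) in
      case ∉-cases m∉ of λ where
        (inj₁ m<j) → rows m∈ m∉ u<fm (b₁₁ m∈ i<m m<j) (b₁₂ m∈ i<m m<j) (b₁₃ m∈ i<m m<j)
        (inj₂ k<m) → let m<1+n = s≤s (proj₂ m∈) in
          rows m∈ m∉ u<fm (b₃₁ m∈ k<m m<1+n) (b₃₂ m∈ k<m m<1+n) (b₃₃ m∈ k<m m<1+n))
    (λ fin →
      let col₁ : ∀ {m} → m ∈[ 1 , n ] → i < m → m < j → ¬ u < f m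
          col₁ m∈ i<m m<j = <-asym (fin m∈ i<m (before-∉ m<j))
          col₃ : ∀ {m} → m ∈[ 1 , n ] → k < m → ¬ u < f m
          col₃ m∈ k<m = <-asym (fin m∈ (<-trans i<k k<m) (after-∉ k<m))
      in (λ m∈ i<m m<j u<fm _ → col₁ m∈ i<m m<j u<fm)
       , (λ m∈ i<m m<j w<fm _ → col₁ m∈ i<m m<j (≤-<-trans u≤w w<fm))
       , (λ m∈ k<m _ u<fm _ → col₃ m∈ k<m u<fm)
       , (λ m∈ k<m _ w<fm _ → col₃ m∈ k<m (≤-<-trans u≤w w<fm)))
    where
    u≤w = <⇒≤ (<-trans u<v v<w)
    rows : m ∈[ 1 , n ] → ¬ m ∈[ j , k ] → u < f m →
      (u < f m → ¬ f m < v) → (v < f m → ¬ f m < w) → (w < f m → ¬ f m < suc n) → ⊥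
    rows {m} m∈ m∉ u<fm r₁ r₂ r₃ with <-cmp (f m) v | <-cmp (f m) w
    ... | tri< lt _ _ | _ = r₁ u<fm lt
    ... | tri≈ _ eq _ | _ = ≢v m∈ m∉ eq
    ... | tri> _ _ v<fm | tri< lt _ _ = r₂ v<fm lt
    ... | tri> _ _ _ | tri≈ _ eq _ = ≢w m∈ m∉ eq
    ... | tri> _ _ _ | tri> _ _ gt = r₃ gt (f<1+n m∈)

-- Enumeration of triples and permutations

-- Pigeonhole principle: removing from `ys` the partner of the first element leaves partners for all
-- the others. A relation in place of a function accommodates partners found by search.
matching-length : (_~_ : A → B → Set) → (∀ {x x′ y} → x ~ y → x′ ~ y → x ≡ x′) →
  ∀ {xs} ys → Unique xs → (∀ {x} → x ∈ xs → ∃[ y ] y ∈ ys × x ~ y) → length xs ≤ length ys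
matching-length _~_ inj ys [] h = z≤n
matching-length _~_ inj {x ∷ xs} ys (x∉ ∷ u) h with h (here refl)
... | y , y∈ , x~y with ∈-∃++ y∈
...   | as , bs , refl = ≤-trans (s≤s (matching-length _~_ inj (as ++ bs) u avoid))
                           (≤-reflexive (sym (length-++-sucʳ as y bs)))
  where
  avoid : ∀ {x′} → x′ ∈ xs → ∃[ y′ ] y′ ∈ as ++ bs × x′ ~ y′
  avoid x′∈ with h (there x′∈)
  ... | y′ , y′∈ , x′~y′ with ∈-++⁻ as y′∈
  ...   | inj₁ y′∈as = y′ , ∈-++⁺ˡ y′∈as , x′~y′
  ...   | inj₂ (here refl) = contradiction (inj x~y x′~y′) (All.lookup x∉ x′∈)
  ...   | inj₂ (there y′∈bs) = y′ , ∈-++⁺ʳ as y′∈bs , x′~y′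

range1-sorted : ∀ n → AllPairs _<_ (range1 n)
range1-sorted n = AllPairs.applyUpTo⁺₁ suc n λ i<j _ → s≤s i<j

range1-unique : ∀ n → Unique (range1 n)
range1-unique n = AllPairs.map <⇒≢ (range1-sorted n)

choose-length : ∀ k ys → is ∈ choose k ys → length is ≡ k
choose-length zero ys (here refl) = refl
choose-length (suc k) (y ∷ ys) is∈ with ∈-++⁻ (map (y ∷_) (choose k ys)) is∈
... | inj₂ is∈′ = choose-length (suc k) ys is∈′
... | inj₁ is∈′ with ∈-map⁻ (y ∷_) is∈′
...   | _ , js∈ , refl = cong suc (choose-length k ys js∈)

choose-⊆ : ∀ k ys → is ∈ choose k ys → All (_∈ ys) is
choose-⊆ zero ys (here refl) = []
choose-⊆ (suc k) (y ∷ ys) is∈ with ∈-++⁻ (map (y ∷_) (choose k ys)) is∈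
... | inj₂ is∈′ = All.map there (choose-⊆ (suc k) ys is∈′)
... | inj₁ is∈′ with ∈-map⁻ (y ∷_) is∈′
...   | _ , js∈ , refl = here refl ∷ All.map there (choose-⊆ k ys js∈)

choose-sorted : ∀ k → AllPairs _<_ ys → is ∈ choose k ys → AllPairs _<_ is
choose-sorted zero _ (here refl) = []
choose-sorted {y ∷ ys} (suc k) (y< ∷ sorted) is∈ with ∈-++⁻ (map (y ∷_) (choose k ys)) is∈
... | inj₂ is∈′ = choose-sorted (suc k) sorted is∈′
... | inj₁ is∈′ with ∈-map⁻ (y ∷_) is∈′
...   | _ , js∈ , refl = All.map (All.lookup y<) (choose-⊆ k ys js∈) ∷ choose-sorted k sorted js∈

-- As `ys` increases, its head can occur in an increasing sublist only as the first entry.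
choose-complete : AllPairs _<_ ys → AllPairs _<_ is → All (_∈ ys) is → is ∈ choose (length is) ys
choose-complete {is = []} _ _ _ = here refl
choose-complete {y ∷ ys} {x ∷ is} (y< ∷ sorted) (x< ∷ sorted′) (x∈ ∷ is∈) = split x∈
  where
  drop-head : ∀ {z} → y < z → z ∈ y ∷ ys → z ∈ ys
  drop-head y<z (here refl) = contradiction refl (<⇒≢ y<z)
  drop-head _   (there z∈)  = z∈
  tail∈ : y ≤ x → All (_∈ ys) is
  tail∈ y≤x = All.zipWith (λ (x<z , z∈) → drop-head (≤-<-trans y≤x x<z) z∈) (x< , is∈)
  split : x ∈ y ∷ ys → x ∷ is ∈ choose (suc (length is)) (y ∷ ys)
  split (here refl) = ∈-++⁺ˡ (∈-map⁺ (y ∷_) (choose-complete sorted sorted′ (tail∈ ≤-refl)))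
  split (there x∈ys) = ∈-++⁺ʳ (map (y ∷_) (choose (length is) ys))
    (choose-complete sorted (x< ∷ sorted′) (x∈ys ∷ tail∈ (<⇒≤ (All.lookup y< x∈ys))))

choose-unique : ∀ k → AllPairs _<_ ys → Unique (choose k ys)
choose-unique zero _ = [] ∷ []
choose-unique (suc k) [] = []
choose-unique {y ∷ ys} (suc k) (y< ∷ sorted) =
  Unique.++⁺ (Unique.map⁺ ∷-injectiveʳ (choose-unique k sorted)) (choose-unique (suc k) sorted) disjoint
  where
  -- Lists of the first kind begin with `y`, those of the second with a larger entry.
  disjoint : ∀ {z} → ¬ (z ∈ map (y ∷_) (choose k ys) × z ∈ choose (suc k) ys)
  disjoint (z∈ , z∈′) with ∈-map⁻ (y ∷_) z∈
  ... | _ , _ , refl = <-irrefl refl (All.lookup y< (All.head (choose-⊆ (suc k) ys z∈′)))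

∈-triples⁻ : is ∈ choose 3 (range1 n) →
  ∃[ i ] ∃[ j ] ∃[ k ] is ≡ i ∷ j ∷ k ∷ [] × 1 ≤ i × i < j × j < k × k ≤ n
∈-triples⁻ {is} {n} is∈ with is | choose-length 3 (range1 n) is∈ | choose-⊆ 3 (range1 n) is∈
                              | choose-sorted 3 (range1-sorted n) is∈
... | i ∷ j ∷ k ∷ [] | refl | i∈ ∷ _ ∷ k∈ ∷ [] | (i<j ∷ _) ∷ (j<k ∷ _) ∷ _ =
  i , j , k , refl , proj₁ (∈-range1⁻ i∈) , i<j , j<k , proj₂ (∈-range1⁻ k∈)

∈-triples⁺ : 1 ≤ i → i < j → j < k → k ≤ n → i ∷ j ∷ k ∷ [] ∈ choose 3 (range1 n)
∈-triples⁺ 1≤i i<j j<k k≤n = choose-complete (range1-sorted _)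
  ((i<j ∷ <-trans i<j j<k ∷ []) ∷ (j<k ∷ []) ∷ [] ∷ [])
  ( ∈-range1⁺ (1≤i , ≤-trans (<⇒≤ (<-trans i<j j<k)) k≤n)
  ∷ ∈-range1⁺ (≤-trans 1≤i (<⇒≤ i<j) , ≤-trans (<⇒≤ j<k) k≤n)
  ∷ ∈-range1⁺ (≤-trans 1≤i (<⇒≤ (<-trans i<j j<k)) , k≤n) ∷ [])

-- Lists of occurrences and their transfer under reversal

occurrences : MeshPattern → List ℕ → List (List ℕ)
occurrences p π = filter (λ is → T? (isOcc p (length π) π is)) (choose (length (τ p)) (range1 (length π)))

occurrences-unique : ∀ p π → Unique (occurrences p π)
occurrences-unique p π = Unique.filter⁺ _ (choose-unique (length (τ p)) (range1-sorted (length π)))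

record Shaded (s : Shape) (α φ : Bool) (f : ℕ → ℕ) (n i j k : ℕ) : Set where
  constructor shaded
  field
    occurs   : Occurrence s f n i j k
    adjacent : T α → Adjacent j k
    final    : T φ → Final f n i j k

length-pattern : ∀ s → length (pattern-of s) ≡ 3
length-pattern inc = refl
length-pattern dec = refl

∈-occurrences⁻ : Shading α φ Q → Permutes (at π) (length π) → is ∈ occurrences (mesh (pattern-of s) Q) π →
  ∃[ i ] ∃[ j ] ∃[ k ] is ≡ i ∷ j ∷ k ∷ [] × Shaded s α φ (at π) (length π) i j k
∈-occurrences⁻ {Q = Q} {π} {s = s} sh perm is∈ with ∈-filter⁻ _ {xs = choose (length (pattern-of s)) (range1 (length π))} is∈
... | is∈′ , t with ∈-triples⁻ {n = length π} (subst (λ l → _ ∈ choose l (range1 (length π))) (length-pattern s) is∈′)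
...   | i , j , k , refl , 1≤i , i<j , j<k , k≤n with to (isOcc⇔ s Q (length π) π) t
...     | (u<v , v<w) , boxes with to (sh _) boxes
...       | r₁ , adj , fin = i , j , k , refl , shaded o (to (adjacent⇔box o) ∘ adj) (to (final⇔boxes u<v v<w r₁) ∘ fin)
  where
  open Boxes {f = at π} {length π} perm s 1≤i i<j j<k k≤n
  o = boxes⇒occurrence u<v v<w r₁

∈-occurrences⁺ : Shading α φ Q → Permutes (at π) (length π) → Shaded s α φ (at π) (length π) i j k →
  i ∷ j ∷ k ∷ [] ∈ occurrences (mesh (pattern-of s) Q) π
∈-occurrences⁺ {Q = Q} {π} {s} {i} {j} {k} sh perm (shaded o adj fin) = ∈-filter⁺ _
  (subst (λ l → _ ∈ choose l (range1 (length π))) (sym (length-pattern s)) (∈-triples⁺ (1≤p G) (p<a G) j<k (b≤n G)))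
  (from (isOcc⇔ s Q (length π) π) ((occurrence⇒u<v o , v<w) ,
    from (sh _) (r₁ , from (adjacent⇔box o) ∘ adj , from (final⇔boxes (occurrence⇒u<v o) v<w r₁) ∘ fin)))
  where
  G = block o
  v<w = low<high o
  j<k = low<high⇒j<k {f = at π} s (a≤b G) v<w
  open Boxes {f = at π} {length π} perm s (1≤p G) (p<a G) j<k (b≤n G)
  r₁ = occurrence⇒boxes o

-- The triple `i`, `j`, `k` goes to `i`, `ρ k`, `ρ j`, which is injective because `ρ` is an
-- involution.
occ-reverse-≤ : ∀ {π π′} → Shading α φ Q → length π′ ≡ length π →
  Permutes (at π) (length π) → Permutes (at π′) (length π) →
  (∀ {x} → x ∈[ 1 , length π ] → Turn (at π) (length π) x (ρ x)) →
  (∀ {m} → m ∈[ 1 , length π ] → at π′ m ≡ at π (ρ m)) →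
  occ (mesh (pattern-of s) Q) π ≤ occ (mesh (pattern-of (opposite s)) Q) π′
occ-reverse-≤ {Q = Q} {ρ} {s} {π} {π′} sh len perm perm′ turns gρ =
  matching-length _~_ ~-inj (occurrences (mesh (pattern-of (opposite s)) Q) π′)
    (occurrences-unique (mesh (pattern-of s) Q) π) match
  where
  open Turning turns
  open Reversal turns gρ
  _~_ : List ℕ → List ℕ → Set
  -- The ranges of `j` and `k` are recorded because `ρ` is known to be injective only on positions.
  is ~ js = ∃[ i ] ∃[ j ] ∃[ k ] is ≡ i ∷ j ∷ k ∷ [] × js ≡ i ∷ ρ k ∷ ρ j ∷ [] × j ∈[ 1 , length π ] × k ∈[ 1 , length π ]
  ρ-inj : x ∈[ 1 , length π ] → y ∈[ 1 , length π ] → ρ x ≡ ρ y → x ≡ y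
  ρ-inj x∈ y∈ eq = trans (sym (ρ-involutive x∈)) (trans (cong ρ eq) (ρ-involutive y∈))
  ~-inj : ∀ {is is′ js} → is ~ js → is′ ~ js → is ≡ is′
  ~-inj (i , j , k , refl , refl , j∈ , k∈) (i′ , j′ , k′ , refl , eq , j′∈ , k′∈)
    with ∷-injective eq
  ... | refl , eq′ with ∷-injective eq′
  ...   | eqk , eq″ = cong₂ (λ a b → i ∷ a ∷ b ∷ []) (ρ-inj j∈ j′∈ (∷-injectiveˡ eq″)) (ρ-inj k∈ k′∈ eqk)
  match : ∀ {is} → is ∈ occurrences (mesh (pattern-of s) Q) π →
    ∃[ js ] js ∈ occurrences (mesh (pattern-of (opposite s)) Q) π′ × is ~ js
  match is∈ with ∈-occurrences⁻ {π = π} {s = s} sh perm is∈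
  ... | i , j , k , refl , shaded o adj fin =
    _ , ∈-occurrences⁺ {π = π′} {s = opposite s} sh (subst (Permutes (at π′)) (sym len) perm′)
          (subst (λ l → Shaded (opposite s) _ _ (at π′) l i (ρ k) (ρ j)) (sym len)
            (shaded (occurrence-reverse s o) (adjacent-reverse G ∘ adj) (final-reverse G ∘ fin)))
      , i , j , k , refl , refl , inside G (≤-refl , a≤b G) , inside G (a≤b G , ≤-refl)
    where G = block o

-- Permutations as lists

at-applyUpTo : ∀ (h : ℕ → ℕ) {n i} → i < n → at (applyUpTo h n) (suc i) ≡ h i
at-applyUpTo h {suc n} {zero} _ = refl
at-applyUpTo h {suc n} {suc i} (s≤s i<n) = at-applyUpTo (h ∘ suc) i<n

at-map-range1 : ∀ (h : ℕ → ℕ) n → m ∈[ 1 , n ] → at (map h (range1 n)) m ≡ h m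
at-map-range1 {suc i} h n (_ , i<n) = trans (cong (λ xs → at xs (suc i)) (map-applyUpTo suc h n)) (at-applyUpTo (h ∘ suc) i<n)

at-extensional : ∀ xs ys → length xs ≡ length ys →
  (∀ {m} → m ∈[ 1 , length xs ] → at xs m ≡ at ys m) → xs ≡ ys
at-extensional [] [] _ _ = refl
at-extensional (x ∷ xs) (y ∷ ys) len eq = cong₂ _∷_ (eq (s≤s z≤n , s≤s z≤n))
  (at-extensional xs ys (suc-injective len) λ { {suc m} (_ , m≤) → eq (s≤s z≤n , s≤s m≤) })

at-∈ : ∀ xs → m ∈[ 1 , length xs ] → at xs m ∈ xs
at-∈ {suc zero} (x ∷ xs) _ = here refl
at-∈ {suc (suc m)} (x ∷ xs) (_ , s≤s m≤) = there (at-∈ xs (s≤s z≤n , m≤))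

∈-at : ∀ {xs} → x ∈ xs → ∃[ m ] m ∈[ 1 , length xs ] × at xs m ≡ x
∈-at (here refl) = 1 , (s≤s z≤n , s≤s z≤n) , refl
∈-at (there x∈) with ∈-at x∈
... | suc m , (_ , m≤) , eq = suc (suc m) , (s≤s z≤n , s≤s m≤) , eq

-- Recasts the step of `words` as a Cartesian product, for which uniqueness and membership lemmas
-- are at hand.
concatMap-∷ : ∀ (xs : List ℕ) yss → concatMap (λ v → map (v ∷_) yss) xs ≡ cartesianProductWith List._∷_ xs yss
concatMap-∷ [] yss = refl
concatMap-∷ (x ∷ xs) yss = cong (map (x ∷_) yss ++_) (concatMap-∷ xs yss)

words-unique : ∀ n l → Unique (words n l)
words-unique n zero = [] ∷ []
words-unique n (suc l) = subst Unique (sym (concatMap-∷ (range1 n) (words n l)))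
  (Unique.cartesianProductWith⁺ List._∷_ ∷-injective (range1-unique n) (words-unique n l))

∈-words⁻ : ∀ n l → π ∈ words n l → length π ≡ l × All (_∈ range1 n) π
∈-words⁻ n zero (here refl) = refl , []
∈-words⁻ n (suc l) π∈
  with ∈-cartesianProductWith⁻ List._∷_ (range1 n) (words n l) (subst (_ ∈_) (concatMap-∷ (range1 n) (words n l)) π∈)
... | v , π′ , v∈ , π′∈ , refl = let len , all∈ = ∈-words⁻ n l π′∈ in cong suc len , v∈ ∷ all∈

∈-words⁺ : ∀ n → All (_∈ range1 n) π → π ∈ words n (length π)
∈-words⁺ n [] = here refl
∈-words⁺ {v ∷ π} n (v∈ ∷ π∈) = subst (_ ∈_) (sym (concatMap-∷ (range1 n) (words n (length π))))
  (∈-cartesianProductWith⁺ List._∷_ v∈ (∈-words⁺ n π∈))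

elemᵇ⇔ : ∀ xs → T (elemᵇ x xs) ⇔ x ∈ xs
elemᵇ⇔ {x} xs = mk⇔ (λ t → Any.map (λ e → sym (≡ᵇ⇒≡ _ x e)) (any⁻ _ xs t))
                    (λ x∈ → any⁺ _ (Any.map (λ e → ≡⇒≡ᵇ _ x (sym e)) x∈))

record IsPermutation (n : ℕ) (π : List ℕ) : Set where
  field
    length≡    : length π ≡ n
    in-range   : All (_∈ range1 n) π
    surjective : All (_∈ π) (range1 n)

∈-Sn⁻ : π ∈ Sn n → IsPermutation n π
∈-Sn⁻ {π} {n} π∈ with ∈-filter⁻ (λ π → T? (isPerm n π)) {xs = words n n} π∈
... | π∈words , t = record
  { length≡ = proj₁ (∈-words⁻ n n π∈words)
  ; in-range = proj₂ (∈-words⁻ n n π∈words)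
  ; surjective = All.map (to (elemᵇ⇔ π)) (all⁺ _ (range1 n) (proj₂ (to (T-∧ {length π ≡ᵇ n}) t)))
  }

∈-Sn⁺ : IsPermutation n π → π ∈ Sn n
∈-Sn⁺ {π = π} record { length≡ = refl ; in-range = r ; surjective = s } =
  ∈-filter⁺ (λ π → T? (isPerm _ π)) (∈-words⁺ _ r)
    (from T-∧ (≡⇒≡ᵇ (length π) _ refl , all⁻ _ (All.map (from (elemᵇ⇔ π)) s)))

-- Were two positions x ≠ y to carry the same value, the n values would all be found at the
-- n − 1 positions other than y.
permutes : IsPermutation (length π) π → Permutes (at π) (length π)
permutes {π} P = record { values = λ m∈ → ∈-range1⁻ (All.lookup in-range (at-∈ π m∈)) ; injective = inj }
  where
  open IsPermutation P
  inj : x ∈[ 1 , length π ] → y ∈[ 1 , length π ] → at π x ≡ at π y → x ≡ y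
  inj {x} {y} x∈ y∈ eq with x ≟ y
  ... | yes x≡y = x≡y
  ... | no x≢y = contradiction
      (matching-length (λ v m → at π m ≡ v) (λ e e′ → trans (sym e) e′) others (range1-unique (length π)) place)
      (<⇒≱ (filter-notAll (λ m → ¬? (m ≟ y)) (range1 (length π)) (Any.map (λ e y≢ → y≢ (sym e)) (∈-range1⁺ y∈))))
    where
    others = filter (λ m → ¬? (m ≟ y)) (range1 (length π))
    place : ∀ {v} → v ∈ range1 (length π) → ∃[ m ] m ∈ others × at π m ≡ v
    place v∈ with ∈-at (All.lookup surjective v∈)
    ... | m , m∈ , e with m ≟ y
    ...   | no m≢y = m , ∈-filter⁺ _ (∈-range1⁺ m∈) m≢y , e
    ...   | yes refl = x , ∈-filter⁺ _ (∈-range1⁺ x∈) x≢y , trans eq e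

-- The involution

turning : List ℕ → ℕ → ℕ
turning π x = proj₁ (turn (at π) (length π) x)

reverse-blocks : List ℕ → List ℕ
reverse-blocks π = map (at π ∘ turning π) (range1 (length π))

length-reverse-blocks : ∀ π → length (reverse-blocks π) ≡ length π
length-reverse-blocks π = trans (length-map (at π ∘ turning π) (range1 (length π))) (length-applyUpTo suc (length π))

turns : ∀ π {x} → x ∈[ 1 , length π ] → Turn (at π) (length π) x (turning π x)
turns π {x} _ = proj₂ (turn (at π) (length π) x)

at-reverse-blocks : ∀ π → m ∈[ 1 , length π ] → at (reverse-blocks π) m ≡ at π (turning π m)
at-reverse-blocks π = at-map-range1 (at π ∘ turning π) (length π)

-- By `turn-stable` both rounds use the same map of positions, and that map is an involution.
reverse-blocks-involutive : ∀ π → reverse-blocks (reverse-blocks π) ≡ π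
reverse-blocks-involutive π = at-extensional π″ π (trans (length-reverse-blocks π′) len) λ m∈ →
  let m∈′ = subst (λ l → _ ∈[ 1 , l ]) (length-reverse-blocks π′) m∈
      m∈″ = subst (λ l → _ ∈[ 1 , l ]) len m∈′
  in trans (at-reverse-blocks π′ m∈′)
       (trans (cong (at π′) (stable m∈″))
       (trans (at-reverse-blocks π (ρ-∈ m∈″)) (cong (at π) (ρ-involutive m∈″))))
  where
  π′ = reverse-blocks π
  π″ = reverse-blocks π′
  len = length-reverse-blocks π
  open Turning (turns π)
  stable : m ∈[ 1 , length π ] → turning π′ m ≡ turning π m
  stable {m} m∈ = turn-stable {g = at π′} (at-reverse-blocks π) m∈
    (subst (λ l → Turn (at π′) l m (turning π′ m)) len (turns π′ {m} (subst (λ l → m ∈[ 1 , l ]) (sym len) m∈)))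

reverse-blocks-permutation : IsPermutation n π → IsPermutation n (reverse-blocks π)
reverse-blocks-permutation {π = π} P@record { length≡ = refl } = record
  { length≡ = length-reverse-blocks π
  ; in-range = All.map⁺ (All.tabulate λ x∈ → All.lookup in-range (at-∈ π (ρ-∈ (∈-range1⁻ x∈))))
  ; surjective = All.map reached surjective
  }
  where
  open IsPermutation P
  open Turning (turns π)
  reached : x ∈ π → x ∈ reverse-blocks π
  reached x∈ with ∈-at x∈
  -- The value at position `m` reappears at position `turning π m`.
  ... | m , m∈ , refl = subst (_∈ reverse-blocks π) (trans (at-reverse-blocks π (ρ-∈ m∈)) (cong (at π) (ρ-involutive m∈)))
    (at-∈ (reverse-blocks π) (subst (λ l → turning π m ∈[ 1 , l ]) (sym (length-reverse-blocks π)) (ρ-∈ m∈)))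

occ-reverse-blocks-≤ : ∀ s → Shading α φ Q → IsPermutation n π →
  occ (mesh (pattern-of s) Q) π ≤ occ (mesh (pattern-of (opposite s)) Q) (reverse-blocks π)
occ-reverse-blocks-≤ {π = π} s sh P@record { length≡ = refl } =
  occ-reverse-≤ {ρ = turning π} {s = s} {π = π} {π′ = reverse-blocks π} sh (length-reverse-blocks π) (permutes P)
    (subst (Permutes (at (reverse-blocks π))) (length-reverse-blocks π)
      (permutes (subst (λ l → IsPermutation l (reverse-blocks π)) (sym (length-reverse-blocks π)) (reverse-blocks-permutation P))))
    (turns π) (at-reverse-blocks π)

opposite-involutive : ∀ s → opposite (opposite s) ≡ s
opposite-involutive inc = refl
opposite-involutive dec = refl

-- One inequality is `occ-reverse-blocks-≤` itself; the other is the same lemma for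
-- `reverse-blocks π` and the opposite shape, both changes being undone by involutivity.
occ-reverse-blocks : ∀ s → Shading α φ Q → IsPermutation n π →
  occ (mesh (pattern-of (opposite s)) Q) (reverse-blocks π) ≡ occ (mesh (pattern-of s) Q) π
occ-reverse-blocks {Q = Q} {π = π} s sh P = ≤-antisym
  (subst₂ (λ s′ π′ → occ (mesh (pattern-of (opposite s)) Q) (reverse-blocks π) ≤ occ (mesh (pattern-of s′) Q) π′)
    (opposite-involutive s) (reverse-blocks-involutive π)
    (occ-reverse-blocks-≤ (opposite s) sh (reverse-blocks-permutation P)))
  (occ-reverse-blocks-≤ s sh P)

-- `reverse-blocks` is injective, being an involution, and carries one statistic to the other;
-- equality follows on swapping the shapes.
count-≤ : ∀ s → Shading α φ Q → ∀ n ℓ →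
  count (mesh (pattern-of s) Q) n ℓ ≤ count (mesh (pattern-of (opposite s)) Q) n ℓ
count-≤ {Q = Q} s sh n ℓ = matching-length (λ π π′ → π′ ≡ reverse-blocks π)
  (λ {π₁} {π₂} e e′ → trans (sym (reverse-blocks-involutive π₁))
    (trans (cong reverse-blocks (trans (sym e) e′)) (reverse-blocks-involutive π₂)))
  _ (Unique.filter⁺ _ (Unique.filter⁺ _ (words-unique n n))) match
  where
  match : ∀ {π} → π ∈ filter (λ π → T? (occ (mesh (pattern-of s) Q) π ≡ᵇ ℓ)) (Sn n) →
    ∃[ π′ ] π′ ∈ filter (λ π → T? (occ (mesh (pattern-of (opposite s)) Q) π ≡ᵇ ℓ)) (Sn n) × π′ ≡ reverse-blocks π
  match {π} π∈ with ∈-filter⁻ (λ π → T? (occ (mesh (pattern-of s) Q) π ≡ᵇ ℓ)) {xs = Sn n} π∈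
  ... | π∈Sn , t = reverse-blocks π
    , ∈-filter⁺ (λ π → T? (occ (mesh (pattern-of (opposite s)) Q) π ≡ᵇ ℓ)) (∈-Sn⁺ {n = n} (reverse-blocks-permutation P))
        (subst (λ o → T (o ≡ᵇ ℓ)) (sym (occ-reverse-blocks s sh P)) t)
    , refl
    where P = ∈-Sn⁻ π∈Sn

equidistributed : Shading α φ Q → mesh p123 Q ∼d mesh p132 Q
equidistributed sh n ℓ = ≤-antisym (count-≤ inc sh n ℓ) (count-≤ dec sh n ℓ)

theorem3p7 : (mesh p123 R1 ∼d mesh p132 R1)
    × (mesh p123 R2 ∼d mesh p132 R2)
    × (mesh p123 R3 ∼d mesh p132 R3)
    × (mesh p123 R4 ∼d mesh p132 R4)
theorem3p7 = equidistributed shading₁ , equidistributed shading₂ , equidistributed shading₃ , equidistributed shading₄
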